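{- Let $R\subseteq\mathbb N\times\mathbb N$ be a binary relation and $f,g:(\mathbb N\to\mathbb N)\to\mathbb N$. There is a map which, given Diophantine witnesses for $f$, $g$ and for the relation $\nu\mapsto R(\nu(1),\nu(0))$, produces a Diophantine witness for the relation $\nu\mapsto R^*(f\nu,g\nu)$, where $R^*$ is the reflexive-transitive closure of $R$.
   Context: Diophantine logic formulas are $A,B::= x_i\doteq n\mid x_i\doteq x_j\mid x_i\doteq x_j\dot+x_k\mid x_i\doteq x_j\dot\times x_k\mid A\dot\wedge B\mid A\dot\vee B\mid\dot\exists A$, with De Bruijn indices. For valuations $\nu:\mathbb N\to\mathbb N$ the semantics is as follows. - Atoms have their obvious meaning, e.g. $[\![x_i\doteq x_j\dot+x_k]\!]\nu\iff\nu(i)=\nu(j)+\nu(k)$. - $\dot\wedge$ and $\dot\vee$ are interpreted as $\wedge$ and $\vee$. - $[\![\dot\exists A]\!]\nu\iff\exists n,\ [\![A]\!](n\cdot\nu)$, with $(n\cdot\nu)(0)=n$ and $(n\cdot\nu)(i+1)=\nu(i)$. A Diophantine witness for a relation $S$ on valuations is a formula $A$ with $[\![A]\!]\nu\leftrightarrow S\,\nu$ for all $\nu$. A Diophantine witness for $f:(\mathbb N\to\mathbb N)\to\mathbb N$ is one for the relation $\nu\mapsto\nu(0)=f(\uparrow\nu)$, where $(\uparrow\nu)(i)=\nu(i+1)$. -}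

module Defs where

open import Data.Nat using (ℕ; zero; suc; _+_; _*_)
open import Data.Product using (Σ; _×_)
open import Data.Sum using (_⊎_)
open import Relation.Binary.PropositionalEquality using (_≡_)
open import Function.Bundles using (_⇔_)
open import Relation.Binary.Construct.Closure.ReflexiveTransitive using (Star)

-- Diophantine logic formulas, variables as De Bruijn indices
data DioForm : Set where
  _≐ᶜ_   : ℕ → ℕ → DioForm
  _≐ᵛ_   : ℕ → ℕ → DioForm
  ≐add   : ℕ → ℕ → ℕ → DioForm
  ≐mul   : ℕ → ℕ → ℕ → DioForm
  _∧̇_    : DioForm → DioForm → DioForm
  _∨̇_    : DioForm → DioForm → DioForm
  ∃̇      : DioForm → DioForm

Val : Set
Val = ℕ → ℕ

_·_ : ℕ → Val → Val
(n · ν) zero = n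
(n · ν) (suc i) = ν i

↑ : Val → Val
↑ ν i = ν (suc i)

⟦_⟧ : DioForm → Val → Set
⟦ i ≐ᶜ n ⟧ ν = ν i ≡ n
⟦ i ≐ᵛ j ⟧ ν = ν i ≡ ν j
⟦ ≐add i j k ⟧ ν = ν i ≡ ν j + ν k
⟦ ≐mul i j k ⟧ ν = ν i ≡ ν j * ν k
⟦ A ∧̇ B ⟧ ν = ⟦ A ⟧ ν × ⟦ B ⟧ ν
⟦ A ∨̇ B ⟧ ν = ⟦ A ⟧ ν ⊎ ⟦ B ⟧ ν
⟦ ∃̇ A ⟧ ν = Σ ℕ (λ n → ⟦ A ⟧ (n · ν))

DioWitnessRel : (Val → Set) → Set
DioWitnessRel S = Σ DioForm (λ A → (ν : Val) → ⟦ A ⟧ ν ⇔ S ν)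

DioWitnessFun : (Val → ℕ) → Set
DioWitnessFun f = DioWitnessRel (λ ν → ν 0 ≡ f (↑ ν))

RTC : (ℕ → ℕ → Set) → ℕ → ℕ → Set
RTC R = Star R

{-# OPTIONS --safe #-}

-- A path of length l from f ν to g ν is coded by Gödel's β function, which leaves one
-- universal quantifier over k < l to eliminate. For that, the values taken by each
-- variable for k = 0, …, l − 1 are packed by Chinese remaindering into a single number,
-- using the pairwise coprime moduli 1 + (k + 1) t with t = q!: a prime factor of such a
-- modulus exceeds q, so bounded values satisfy an equation as soon as it holds modulo
-- that prime, and the l equations merge into one congruence modulo the product.
-- This needs products of arithmetic progressions to be Diophantine, which reduces
-- to binomial coefficients and factorials, these to exponentials, and exponentials to
-- the solutions of the Pell equation, following Matiyasevich.
module Submission where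

open import Defs
open import Data.Nat using (ℕ; zero; suc; _+_; _*_; _∸_; _^_; _!; _≤_; _<_; _≤?_; _<?_; _/_; _%_; z≤n; s≤s; NonZero; >-nonZero; >-nonZero⁻¹)
open import Data.Nat.Properties
open import Data.Nat.Combinatorics using (_C_; nCk+nC[k+1]≡[n+1]C[k+1]; k>n⇒nCk≡0; nC1≡n; nCn≡1; nCk≡nC[n∸k])
open import Data.Nat.Coprimality using (Coprime; coprime-divisor; coprime-Bézout)
open import Data.Nat.DivMod using (m≡m%n+[m/n]*n; m%n<n)
open import Data.Nat.Divisibility
open import Data.Nat.GCD using (module Bézout)
open import Data.Nat.Induction using (<-rec)
open import Data.Nat.ListAction using (product)
open import Data.Nat.Primality using (Prime; euclidsLemma; prime⇒nonZero)
open import Data.Nat.Primality.Factorisation using (PrimeFactorisation; factorise)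
open import Data.Nat.Tactic.RingSolver using (solve-∀)
open import Data.List using (List; []; _∷_)
open import Data.List.Relation.Unary.All using (All; _∷_)
open import Data.Product using (Σ; ∃; _×_; _,_; proj₁; proj₂)
open import Data.Sum using (_⊎_; inj₁; inj₂; map₁; map₂; [_,_]′)
open import Function using (_∘_; id)
open import Function.Bundles using (_⇔_; mk⇔; Equivalence)
open import Relation.Binary.Construct.Closure.ReflexiveTransitive using (Star; ε; _◅_; _◅◅_)
open import Relation.Binary.PropositionalEquality
open import Relation.Nullary using (¬_; yes; no; contradiction)

open Equivalence using (to; from)

-- Diophantine relations

-- The formula under the bounded quantifier is arbitrary rather than a single polynomial equation,
-- so the elimination has to pass through disjunctions and nested quantifiers. The moduli need not
-- be prime, and only modulo a prime can a guard be cancelled or a product be split. The two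
-- directions therefore differ: soundness picks one prime factor of the modulus for each k, while
-- completeness uses only that the moduli are pairwise coprime. The order of choice matters: first a
-- bound u on all witnesses, then q above all values of atoms, then t, and only then the packed
-- numbers. Everything stays in ℕ. The difference sequence `δ` is primitive, and negative terms of
-- the classical identities are moved to the other side.

Dio : (Val → Set) → Set
Dio = DioWitnessRel

private
  variable
    S T : Val → Set

dio-⇔ : (S : Val → Set) → Dio S → (∀ ν → S ν ⇔ T ν) → Dio T
dio-⇔ S (A , w) h = A , λ ν → mk⇔ (to (h ν) ∘ to (w ν)) (from (w ν) ∘ from (h ν))

infixr 3 _∧ᴰ_
_∧ᴰ_ : Dio S → Dio T → Dio (λ ν → S ν × T ν)
(A , v) ∧ᴰ (B , w) = A ∧̇ B , λ ν →
  mk⇔ (λ (a , b) → to (v ν) a , to (w ν) b) (λ (s , t) → from (v ν) s , from (w ν) t)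

dio-∨ : Dio S → Dio T → Dio (λ ν → S ν ⊎ T ν)
dio-∨ (A , v) (B , w) = A ∨̇ B , λ ν → mk⇔
  (λ { (inj₁ a) → inj₁ (to (v ν) a) ; (inj₂ b) → inj₂ (to (w ν) b) })
  (λ { (inj₁ s) → inj₁ (from (v ν) s) ; (inj₂ t) → inj₂ (from (w ν) t) })

dio-∃ : {S : ℕ → Val → Set} → Dio (λ ν → S (ν 0) (↑ ν)) → Dio (λ ν → Σ ℕ (λ n → S n ν))
dio-∃ (A , w) = ∃̇ A , λ ν →
  mk⇔ (λ (n , a) → n , to (w (n · ν)) a) (λ (n , s) → n , from (w (n · ν)) s)

-- Polynomial terms and substitution

infixl 6 _⊕_
infixl 7 _⊗_

data Term : Set where
  #_      : ℕ → Term
  con     : ℕ → Term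
  _⊕_ _⊗_ : Term → Term → Term

infix 8 #_

eval : Term → Val → ℕ
eval (# i) ν = ν i
eval (con n) ν = n
eval (s ⊕ t) ν = eval s ν + eval t ν
eval (s ⊗ t) ν = eval s ν * eval t ν

-- Fresh quantified variables name the values of the two subterms; the renaming `ρ` absorbs the
-- shift by two that they cause.
dio-value : ∀ t (ρ : ℕ → ℕ) i → Dio (λ ν → ν i ≡ eval t (λ j → ν (ρ j)))
dio-value (# j) ρ i = (i ≐ᵛ ρ j) , λ ν → mk⇔ id id
dio-value (con n) ρ i = (i ≐ᶜ n) , λ ν → mk⇔ id id
dio-value (s ⊕ t) ρ i = dio-⇔
  (λ ν → Σ ℕ λ a → Σ ℕ λ b →
    a ≡ eval s (λ j → ν (ρ j)) × b ≡ eval t (λ j → ν (ρ j)) × ν i ≡ a + b)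
  (dio-∃ (dio-∃ (dio-value s (suc ∘ suc ∘ ρ) 1 ∧ᴰ dio-value t (suc ∘ suc ∘ ρ) 0 ∧ᴰ
    (≐add (2 + i) 1 0 , λ ν → mk⇔ id id))))
  (λ ν → mk⇔ (λ { (_ , _ , refl , refl , p) → p }) (λ p → _ , _ , refl , refl , p))
dio-value (s ⊗ t) ρ i = dio-⇔
  (λ ν → Σ ℕ λ a → Σ ℕ λ b →
    a ≡ eval s (λ j → ν (ρ j)) × b ≡ eval t (λ j → ν (ρ j)) × ν i ≡ a * b)
  (dio-∃ (dio-∃ (dio-value s (suc ∘ suc ∘ ρ) 1 ∧ᴰ dio-value t (suc ∘ suc ∘ ρ) 0 ∧ᴰ
    (≐mul (2 + i) 1 0 , λ ν → mk⇔ id id))))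
  (λ ν → mk⇔ (λ { (_ , _ , refl , refl , p) → p }) (λ p → _ , _ , refl , refl , p))

dio-≡ : ∀ s t → Dio (λ ν → eval s ν ≡ eval t ν)
dio-≡ s t = dio-⇔ (λ ν → Σ ℕ λ a → a ≡ eval s ν × a ≡ eval t ν)
  (dio-∃ (dio-value s suc 0 ∧ᴰ dio-value t suc 0))
  (λ ν → mk⇔ (λ (_ , p , q) → trans (sym p) q) (λ p → _ , refl , p))

wk : Term → Term
wk (# i) = # suc i
wk (con n) = con n
wk (s ⊕ t) = wk s ⊕ wk t
wk (s ⊗ t) = wk s ⊗ wk t

eval-wk : ∀ t ν → eval (wk t) ν ≡ eval t (↑ ν)
eval-wk (# i) ν = refl
eval-wk (con k) ν = refl
eval-wk (s ⊕ t) ν = cong₂ _+_ (eval-wk s ν) (eval-wk t ν)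
eval-wk (s ⊗ t) ν = cong₂ _*_ (eval-wk s ν) (eval-wk t ν)

lift : (ℕ → Term) → ℕ → Term
lift σ zero = # 0
lift σ (suc i) = wk (σ i)

-- Stands in for function extensionality, which would turn pointwise equal valuations into equal
-- ones.
⟦⟧-cong : ∀ A {μ ν} → μ ≗ ν → ⟦ A ⟧ μ → ⟦ A ⟧ ν
⟦⟧-cong (i ≐ᶜ n) h p = trans (sym (h i)) p
⟦⟧-cong (i ≐ᵛ j) h p = trans (sym (h i)) (trans p (h j))
⟦⟧-cong (≐add i j k) h p = trans (sym (h i)) (trans p (cong₂ _+_ (h j) (h k)))
⟦⟧-cong (≐mul i j k) h p = trans (sym (h i)) (trans p (cong₂ _*_ (h j) (h k)))
⟦⟧-cong (A ∧̇ B) h (a , b) = ⟦⟧-cong A h a , ⟦⟧-cong B h b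
⟦⟧-cong (A ∨̇ B) h (inj₁ a) = inj₁ (⟦⟧-cong A h a)
⟦⟧-cong (A ∨̇ B) h (inj₂ b) = inj₂ (⟦⟧-cong B h b)
⟦⟧-cong (∃̇ A) h (n , a) = n , ⟦⟧-cong A (λ { zero → refl ; (suc i) → h i }) a

dio-substitute : ∀ A (σ : ℕ → Term) → Dio (λ ν → ⟦ A ⟧ (λ i → eval (σ i) ν))
dio-substitute (i ≐ᶜ n) σ = dio-≡ (σ i) (con n)
dio-substitute (i ≐ᵛ j) σ = dio-≡ (σ i) (σ j)
dio-substitute (≐add i j k) σ = dio-≡ (σ i) (σ j ⊕ σ k)
dio-substitute (≐mul i j k) σ = dio-≡ (σ i) (σ j ⊗ σ k)
dio-substitute (A ∧̇ B) σ = dio-substitute A σ ∧ᴰ dio-substitute B σ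
dio-substitute (A ∨̇ B) σ = dio-∨ (dio-substitute A σ) (dio-substitute B σ)
dio-substitute (∃̇ A) σ = dio-∃ {S = λ n ν → ⟦ A ⟧ (n · λ i → eval (σ i) ν)}
  (dio-⇔ (λ ν → ⟦ A ⟧ (λ i → eval (lift σ i) ν)) (dio-substitute A (lift σ))
    (λ ν → mk⇔ (⟦⟧-cong A (lift-eval ν)) (⟦⟧-cong A (λ i → sym (lift-eval ν i)))))
  where
  lift-eval : ∀ ν i → eval (lift σ i) ν ≡ (ν 0 · λ i → eval (σ i) (↑ ν)) i
  lift-eval ν zero = refl
  lift-eval ν (suc i) = eval-wk (σ i) ν

args : List Term → ℕ → Term
args [] i = # i
args (t ∷ ts) zero = t
args (t ∷ ts) (suc i) = args ts i

-- `τ` is given apart from `σ` because a valuation assembled with `_·_` agrees with the evaluated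
-- terms only pointwise.
dio-at : Dio S → (τ : Val → Val) (σ : ℕ → Term) → (∀ ν i → eval (σ i) ν ≡ τ ν i) → Dio (λ ν → S (τ ν))
dio-at (A , w) τ σ h = dio-⇔ _ (dio-substitute A σ) λ ν → mk⇔
  (λ p → to (w (τ ν)) (⟦⟧-cong A (h ν) p))
  (λ s → ⟦⟧-cong A (λ i → sym (h ν i)) (from (w (τ ν)) s))

dio-app : Dio S → (ts : List Term) → Dio (λ ν → S (λ i → eval (args ts i) ν))
dio-app D ts = dio-at D _ (args ts) (λ ν i → refl)

dio-≤ : ∀ s t → Dio (λ ν → eval s ν ≤ eval t ν)
dio-≤ s t = dio-app {S = λ ν → ν 0 ≤ ν 1}
  (dio-⇔ (λ ν → Σ ℕ λ k → k + ν 0 ≡ ν 1) (dio-∃ (dio-≡ (# 0 ⊕ # 1) (# 2)))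
    (λ ν → mk⇔ (λ (k , p) → ≤-trans (m≤n+m _ k) (≤-reflexive p)) (λ p → _ , m∸n+n≡m p)))
  (s ∷ t ∷ [])

dio-< : ∀ s t → Dio (λ ν → eval s ν < eval t ν)
dio-< s t = dio-≤ (con 1 ⊕ s) t

dio-∣ : ∀ s t → Dio (λ ν → eval s ν ∣ eval t ν)
dio-∣ s t = dio-app {S = λ ν → ν 0 ∣ ν 1}
  (dio-⇔ (λ ν → Σ ℕ λ k → ν 1 ≡ k * ν 0) (dio-∃ (dio-≡ (# 2) (# 0 ⊗ # 1)))
    (λ ν → mk⇔ (λ (k , p) → divides k p) (λ { (divides k p) → k , p })))
  (s ∷ t ∷ [])

-- Congruences

-- An identity that is a consequence of l ≡ r is checked as a semiring identity
-- after adding c times the two sides of the hypothesis crosswise.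
by-adding : ∀ {x y l r} c → l ≡ r → x + c * r ≡ y + c * l → x ≡ y
by-adding {x} {y} c refl = +-cancelʳ-≡ _ x y

infix 4 _≈_[_]

-- Two natural multipliers replace one integer multiplier, so neither truncated subtraction nor a
-- comparison of a and b is needed.
record _≈_[_] (a b m : ℕ) : Set where
  constructor mod
  field
    lower upper : ℕ
    balance     : a + lower * m ≡ b + upper * m

≈-reflexive : ∀ {a b m} → a ≡ b → a ≈ b [ m ]
≈-reflexive refl = mod 0 0 refl

≈-refl : ∀ {a m} → a ≈ a [ m ]
≈-refl = ≈-reflexive refl

≈-sym : ∀ {a b m} → a ≈ b [ m ] → b ≈ a [ m ]
≈-sym (mod x y p) = mod y x (sym p)

≈-trans : ∀ {a b m c} → a ≈ b [ m ] → b ≈ c [ m ] → a ≈ c [ m ]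
≈-trans {a} {b} {m} {c} (mod x y p) (mod z w q) =
  mod (x + z) (y + w) (by-adding 1 p (by-adding 1 q (identity a b c m x y z w)))
  where
  identity : ∀ a b c m x y z w →
    a + (x + z) * m + 1 * (b + y * m) + 1 * (c + w * m) ≡
    c + (y + w) * m + 1 * (a + x * m) + 1 * (b + z * m)
  identity = solve-∀

≈-+ : ∀ {a b m c d} → a ≈ b [ m ] → c ≈ d [ m ] → a + c ≈ b + d [ m ]
≈-+ {a} {b} {m} {c} {d} (mod x y p) (mod z w q) = mod (x + z) (y + w)
  (trans (shuffle a x c z m) (trans (cong₂ _+_ p q) (sym (shuffle b y d w m))))
  where
  shuffle : ∀ a x c z m → a + c + (x + z) * m ≡ (a + x * m) + (c + z * m)
  shuffle = solve-∀

≈-*ˡ : ∀ {a b m} k → a ≈ b [ m ] → k * a ≈ k * b [ m ]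
≈-*ˡ {a} {b} {m} k (mod x y p) = mod (k * x) (k * y)
  (trans (factor k a x m) (trans (cong (k *_) p) (sym (factor k b y m))))
  where
  factor : ∀ k a x m → k * a + k * x * m ≡ k * (a + x * m)
  factor = solve-∀

≈-*ʳ : ∀ {a b m} k → a ≈ b [ m ] → a * k ≈ b * k [ m ]
≈-*ʳ {a} {b} {m} k p = subst₂ _≈_[ m ] (*-comm k a) (*-comm k b) (≈-*ˡ k p)

≈-* : ∀ {a b m c d} → a ≈ b [ m ] → c ≈ d [ m ] → a * c ≈ b * d [ m ]
≈-* {b = b} {c = c} p q = ≈-trans (≈-*ʳ c p) (≈-*ˡ b q)

≈-cancelʳ : ∀ {a c b d m} → a + c ≈ b + d [ m ] → c ≈ d [ m ] → a ≈ b [ m ]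
≈-cancelʳ {a} {c} {b} {d} {m} (mod x y p) (mod z w q) =
  mod (x + w) (y + z) (by-adding 1 p (by-adding 1 (sym q) (identity a b c d m x y z w)))
  where
  identity : ∀ a b c d m x y z w →
    a + (x + w) * m + 1 * (b + d + y * m) + 1 * (c + z * m) ≡
    b + (y + z) * m + 1 * (a + c + x * m) + 1 * (d + w * m)
  identity = solve-∀

≈-cancelˡ : ∀ {c a d b m} → c + a ≈ d + b [ m ] → c ≈ d [ m ] → a ≈ b [ m ]
≈-cancelˡ {c} {a} {d} {b} {m} p q = ≈-cancelʳ (subst₂ _≈_[ m ] (+-comm c a) (+-comm d b) p) q

≈-drop : ∀ {m} a k → a + k * m ≈ a [ m ]
≈-drop {m} a k = mod 0 k (+-identityʳ (a + k * m))

∣⇒≈0 : ∀ {m a} → m ∣ a → a ≈ 0 [ m ]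
∣⇒≈0 (divides k refl) = ≈-drop 0 k

≈0⇒∣ : ∀ {a m} → a ≈ 0 [ m ] → m ∣ a
≈0⇒∣ {a} {m} (mod x y p) = ∣m+n∣m⇒∣n (divides y (trans (+-comm (x * m) a) p)) (divides x refl)

≈-∣ : ∀ {a b m} → a ≈ b [ m ] → m ∣ a → m ∣ b
≈-∣ p q = ≈0⇒∣ (≈-trans (≈-sym p) (∣⇒≈0 q))

≈-coarsen : ∀ {n m a b} → n ∣ m → a ≈ b [ m ] → a ≈ b [ n ]
≈-coarsen {n} {a = a} {b} (divides k refl) (mod x y p) = mod (x * k) (y * k)
  (trans (cong (a +_) (*-assoc x k n)) (trans p (cong (b +_) (sym (*-assoc y k n)))))

≈-+⇒∣ : ∀ {a d m} → a ≈ a + d [ m ] → m ∣ d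
≈-+⇒∣ {a} {d} {m} p = ≈0⇒∣ (≈-cancelˡ (≈-trans (≈-sym p) (≈-reflexive (sym (+-identityʳ a)))) (≈-refl {a}))

∣-small : ∀ {m a} → m ∣ a → a < m → a ≡ 0
∣-small {a = zero} p q = refl
∣-small {a = suc a} p q = contradiction p (>⇒∤ q)

≈-unique : ∀ {a b m} → a ≈ b [ m ] → a < m → b < m → a ≡ b
≈-unique {a} {b} {m} p a<m b<m with ≤-total a b
... | inj₁ a≤b = trans (sym (+-identityʳ a)) (trans (cong (a +_) (sym d≡0)) (m+[n∸m]≡n a≤b))
  where
  d≡0 = ∣-small (≈-+⇒∣ (subst (λ z → a ≈ z [ m ]) (sym (m+[n∸m]≡n a≤b)) p)) (≤-<-trans (m∸n≤m b a) b<m)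
... | inj₂ b≤a = sym (trans (sym (+-identityʳ b)) (trans (cong (b +_) (sym d≡0)) (m+[n∸m]≡n b≤a)))
  where
  d≡0 = ∣-small (≈-+⇒∣ (subst (λ z → b ≈ z [ m ]) (sym (m+[n∸m]≡n b≤a)) (≈-sym p))) (≤-<-trans (m∸n≤m a b) a<m)

dio-≈ : ∀ s t u → Dio (λ ν → eval s ν ≈ eval t ν [ eval u ν ])
dio-≈ s t u = dio-app {S = λ ν → ν 0 ≈ ν 1 [ ν 2 ]}
  (dio-⇔ (λ ν → Σ ℕ λ x → Σ ℕ λ y → ν 0 + x * ν 2 ≡ ν 1 + y * ν 2)
    (dio-∃ (dio-∃ (dio-≡ (# 2 ⊕ # 1 ⊗ # 4) (# 3 ⊕ # 0 ⊗ # 4))))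
    (λ ν → mk⇔ (λ (x , y , p) → mod x y p) (λ (mod x y p) → x , y , p)))
  (s ∷ t ∷ u ∷ [])

-- Lucas sequences

-- α e n solves a (n + 2) = (e + 2) a (n + 1) − a n with a 0 = 0 and a 1 = 1,
-- and δ e n = α e (n + 1) − α e n.
mutual
  α : ℕ → ℕ → ℕ
  α e zero = 0
  α e (suc n) = α e n + δ e n

  δ : ℕ → ℕ → ℕ
  δ e zero = 1
  δ e (suc n) = δ e n + e * α e (suc n)

-- With y = a n and y + d = a (n + 1) this is the invariant a (n + 1)² - (e + 2) a n a (n + 1) + (a
-- n)² = 1 of the recurrence.
Pell : ℕ → ℕ → ℕ → Set
Pell e y d = d * d ≡ e * ((y + d) * y) + 1

pell : ∀ e n → Pell e (α e n) (δ e n)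
pell e zero = cong (_+ 1) (sym (trans (cong (e *_) (*-zeroʳ 1)) (*-zeroʳ e)))
pell e (suc n) = by-adding 1 (pell e n) (identity e (α e n) (δ e n))
  where
  identity : ∀ e y d →
    (d + e * (y + d)) * (d + e * (y + d)) + 1 * (e * ((y + d) * y) + 1) ≡
    e * ((y + d + (d + e * (y + d))) * (y + d)) + 1 + 1 * (d * d)
  identity = solve-∀

0<δ : ∀ e n → 0 < δ e n
0<δ e zero = s≤s z≤n
0<δ e (suc n) = ≤-trans (0<δ e n) (m≤m+n _ _)

α-step : ∀ e n → α e n < α e (suc n)
α-step e n = m<m+n (α e n) (0<δ e n)

α-mono-≤ : ∀ e {m n} → m ≤ n → α e m ≤ α e n
α-mono-≤ e {m} {n} m≤n = subst (λ k → α e m ≤ α e k) (m∸n+n≡m m≤n) (climb (n ∸ m))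
  where
  climb : ∀ k → α e m ≤ α e (k + m)
  climb zero = ≤-refl
  climb (suc k) = ≤-trans (climb k) (<⇒≤ (α-step e (k + m)))

α-mono-< : ∀ e {m n} → m < n → α e m < α e n
α-mono-< e {m} m<n = <-≤-trans (α-step e m) (α-mono-≤ e m<n)

n≤α : ∀ e n → n ≤ α e n
n≤α e zero = z≤n
n≤α e (suc n) = ≤-trans (s≤s (n≤α e n)) (α-step e n)

α≡0 : ∀ e n → α e n ≡ 0 → n ≡ 0
α≡0 e n p = n≤0⇒n≡0 (subst (n ≤_) p (n≤α e n))

α-≈ : ∀ {e f m} n → e ≈ f [ m ] → α e n ≈ α f n [ m ]
δ-≈ : ∀ {e f m} n → e ≈ f [ m ] → δ e n ≈ δ f n [ m ]
α-≈ zero p = ≈-refl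
α-≈ (suc n) p = ≈-+ (α-≈ n p) (δ-≈ n p)
δ-≈ zero p = ≈-refl
δ-≈ (suc n) p = ≈-+ (δ-≈ n p) (≈-* p (α-≈ (suc n) p))

δ-zero : ∀ n → δ 0 n ≡ 1
δ-zero zero = refl
δ-zero (suc n) = trans (+-identityʳ _) (δ-zero n)

-- Together with `α-≈` this reads the index n off `α w n` modulo any divisor of w.
α-zero : ∀ n → α 0 n ≡ n
α-zero zero = refl
α-zero (suc n) = trans (cong₂ _+_ (α-zero n) (δ-zero n)) (+-comm n 1)

-- The smaller solution (y′ , d′) has d = d′ + e y and y = y′ + d′.
pell-index : ∀ e y d → Pell e y d → ∃ λ n → y ≡ α e n × d ≡ δ e n
pell-index e = <-rec _ step
  where
  step : ∀ y → (∀ {y′} → y′ < y → ∀ d → Pell e y′ d → ∃ λ n → y′ ≡ α e n × d ≡ δ e n) →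
         ∀ d → Pell e y d → ∃ λ n → y ≡ α e n × d ≡ δ e n
  step zero _ d p = 0 , refl , m*n≡1⇒m≡1 d d (trans p (cong (_+ 1) (trans (cong (e *_) (*-zeroʳ d)) (*-zeroʳ e))))
  -- The equation rules out both bad comparisons: d < e y would give d² ≤ e y d, which is too small,
  -- and d′ > y would give d′² + e y d′ > e y² + 1. So the smaller solution lies in ℕ.
  step y@(suc z) rec d p with e * y ≤? d
  ... | no ey≰d = contradiction (subst (_≤ e * y * d) p (*-monoˡ-≤ d (<⇒≤ (≰⇒> ey≰d))))
    (<⇒≱ (subst (e * y * d <_) (sym (expand e y d)) (s≤s (m≤m+n _ _))))
    where
    expand : ∀ e y d → e * ((y + d) * y) + 1 ≡ suc (e * y * d + e * y * y)
    expand = solve-∀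
  ... | yes ey≤d with m≤n⇒∃[o]m+o≡n ey≤d
  ... | d′ , refl with d′ ≤? y
  ... | no d′≰y = contradiction reduced (<⇒≢ large ∘ sym)
    where
    reduced : d′ * d′ + e * y * d′ ≡ e * y * y + 1
    reduced = by-adding 1 p (identity e y d′)
      where
      identity : ∀ e y d → d * d + e * y * d + 1 * (e * ((y + (e * y + d)) * y) + 1) ≡
                           e * y * y + 1 + 1 * ((e * y + d) * (e * y + d))
      identity = solve-∀
    y<d′ = ≰⇒> d′≰y
    large : e * y * y + 1 < d′ * d′ + e * y * d′
    large = subst (_< d′ * d′ + e * y * d′) (+-comm 1 (e * y * y))
      (+-mono-<-≤ (*-mono-< {1} {d′} {1} {d′} 1<d′ 1<d′) (*-monoʳ-≤ (e * y) (<⇒≤ y<d′)))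
      where
      1<d′ : 1 < d′
      1<d′ = ≤-trans (s≤s (s≤s z≤n)) y<d′
  ... | yes d′≤y with m≤n⇒∃[o]m+o≡n d′≤y
  ... | y′ , q = result
    where
    reduced : ∀ y → d′ + y′ ≡ y → Pell e y (e * y + d′) → Pell e y′ d′
    reduced _ refl p = by-adding 1 p (identity e y′ d′)
      where
      identity : ∀ e y d →
        d * d + 1 * (e * ((d + y + (e * (d + y) + d)) * (d + y)) + 1) ≡
        e * ((y + d) * y) + 1 + 1 * ((e * (d + y) + d) * (e * (d + y) + d))
      identity = solve-∀
    0<d′ : 0 < d′
    0<d′ = n≢0⇒n>0 λ { refl → contradiction (reduced y q p) (<⇒≢ (≤-trans (s≤s z≤n) (m≤n+m 1 _))) }
    result : ∃ λ n → y ≡ α e n × e * y + d′ ≡ δ e n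
    result with rec (subst (y′ <_) q (m<n+m y′ 0<d′)) d′ (reduced y q p)
    ... | n , y′≡ , d′≡ = suc n , y≡ , trans (+-comm (e * y) d′) (cong₂ _+_ d′≡ (cong (e *_) y≡))
      where
      y≡ : y ≡ α e (suc n)
      y≡ = trans (sym q) (trans (+-comm d′ y′) (cong₂ _+_ y′≡ d′≡))

-- The n-th power of the fundamental unit is δ e n + (α e n) θ with θ² = e - e θ; these are the two
-- coordinates of the product of the m-th and n-th powers.
α-+ : ∀ e m n → α e (m + n) + e * (α e m * α e n) ≡ α e m * δ e n + δ e m * α e n
δ-+ : ∀ e m n → δ e (m + n) ≡ δ e m * δ e n + e * (α e m * α e n)
α-+ e zero n = cong (α e n +_) (*-zeroʳ e)
α-+ e (suc m) n = by-adding 1 (α-+ e m n) (by-adding 1 (δ-+ e m n)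
  (identity e (α e m) (δ e m) (α e n) (δ e n) (α e (m + n)) (δ e (m + n))))
  where
  identity : ∀ e y d z c p q →
    p + q + e * ((y + d) * z) + 1 * (y * c + d * z) + 1 * (d * c + e * (y * z)) ≡
    (y + d) * c + (d + e * (y + d)) * z + 1 * (p + e * (y * z)) + 1 * q
  identity = solve-∀
δ-+ e zero n = sym (trans (cong₂ _+_ (+-identityʳ (δ e n)) (*-zeroʳ e)) (+-identityʳ (δ e n)))
δ-+ e (suc m) n = by-adding e (α-+ e m n) (by-adding (1 + e) (δ-+ e m n)
  (identity e (α e m) (δ e m) (α e n) (δ e n) (α e (m + n)) (δ e (m + n))))
  where
  identity : ∀ e y d z c p q →
    q + e * (p + q) + e * (y * c + d * z) + (1 + e) * (d * c + e * (y * z)) ≡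
    (d + e * (y + d)) * c + e * ((y + d) * z) + e * (p + e * (y * z)) + (1 + e) * q
  identity = solve-∀

δ²≈1 : ∀ e n → δ e n * δ e n ≈ 1 [ α e n ]
δ²≈1 e n = ≈-trans (≈-reflexive (trans (pell e n) (rearrange e (α e n) (δ e n)))) (≈-drop 1 (e * (α e n + δ e n)))
  where
  rearrange : ∀ e y d → e * ((y + d) * y) + 1 ≡ 1 + e * (y + d) * y
  rearrange = solve-∀

α-+≈ : ∀ e m n → α e (m + n) ≈ δ e m * α e n [ α e m ]
α-+≈ e m n = mod (e * α e n) (δ e n)
  (trans (cong (α e (m + n) +_) (swap e (α e n) (α e m)))
  (trans (α-+ e m n) (trans (+-comm _ (δ e m * α e n)) (cong (δ e m * α e n +_) (*-comm (α e m) (δ e n))))))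
  where
  swap : ∀ e z y → e * z * y ≡ e * (y * z)
  swap = solve-∀

δ-+≈ : ∀ e m n → δ e (m + n) ≈ δ e m * δ e n [ α e m ]
δ-+≈ e m n = ≈-trans (≈-reflexive (trans (δ-+ e m n) (cong (δ e m * δ e n +_) (swap e (α e m) (α e n)))))
  (≈-drop _ (e * α e n))
  where
  swap : ∀ e y z → e * (y * z) ≡ e * z * y
  swap = solve-∀

δ-*≈ : ∀ e k l → δ e (l * k) ≈ δ e k ^ l [ α e k ]
δ-*≈ e k zero = ≈-refl
δ-*≈ e k (suc l) = ≈-trans (δ-+≈ e k (l * k)) (≈-*ˡ (δ e k) (δ-*≈ e k l))

^²≈1 : ∀ {x m} l → x * x ≈ 1 [ m ] → x ^ l * x ^ l ≈ 1 [ m ]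
^²≈1 zero p = ≈-refl
^²≈1 {x} {m} (suc l) p = subst (_≈ 1 [ m ]) (sym (regroup x (x ^ l))) (≈-* p (^²≈1 l p))
  where
  regroup : ∀ x y → x * y * (x * y) ≡ x * x * (y * y)
  regroup = solve-∀

∣-cancel-unit : ∀ {m x z} → x * x ≈ 1 [ m ] → m ∣ x * z → m ∣ z
∣-cancel-unit {m} {x} {z} p q =
  ≈-∣ (≈-trans (≈-reflexive (sym (*-assoc x x z))) (≈-trans (≈-*ʳ z p) (≈-reflexive (*-identityˡ z)))) (∣n⇒∣m*n x q)

-- The quotient is l (δ e k)^(l − 1); the exponent may be raised by 2, since δ e k
-- squares to 1 modulo α e k.
α-quotient : ∀ e k l → 0 < k → ∃ λ q → α e (l * k) ≡ q * α e k × q ≈ l * δ e k ^ suc l [ α e k ]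
α-quotient e k zero 0<k = 0 , refl , ≈-refl
α-quotient e k (suc l) 0<k with α-quotient e k l 0<k
... | q , p , q≈ = q′ , p′ , q′≈
  where
  u = α e k
  x = δ e k
  D = δ e (l * k)
  instance
    u≢0 : NonZero u
    u≢0 = >-nonZero (≤-trans 0<k (n≤α e k))
  split : α e (k + l * k) + e * q * u * u ≡ (D + x * q) * u
  split = by-adding 1 (subst (λ z → α e (k + l * k) + e * (u * z) ≡ u * D + x * z) p (α-+ e k (l * k)))
    (identity e u x q (δ e (l * k)) (α e (k + l * k)))
    where
    identity : ∀ e u x q d p → p + e * q * u * u + 1 * (u * d + x * (q * u)) ≡
                               (d + x * q) * u + 1 * (p + e * (u * (q * u)))
    identity = solve-∀
  u∣ : u ∣ α e (k + l * k)
  u∣ = ∣m+n∣m⇒∣n (subst (u ∣_) (trans (sym split) (+-comm _ (e * q * u * u))) (n∣m*n (D + x * q)))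
    (n∣m*n (e * q * u))
  q′ = quotient u∣
  p′ : α e (k + l * k) ≡ q′ * u
  p′ = _∣_.equality u∣
  quotient-split : q′ + e * q * u ≡ D + x * q
  quotient-split = *-cancelʳ-≡ _ _ u
    (trans (*-distribʳ-+ u q′ (e * q * u)) (trans (cong (_+ e * q * u * u) (sym p′)) split))
  q′≈ : q′ ≈ suc l * (x * x ^ suc l) [ u ]
  q′≈ = ≈-trans (mod (e * q) 0 (trans quotient-split (sym (+-identityʳ _))))
    (≈-+ (≈-trans (δ-*≈ e k l) (≈-sym (≈-trans (≈-reflexive (sym (*-assoc x x (x ^ l))))
                                       (≈-trans (≈-*ʳ (x ^ l) (δ²≈1 e k)) (≈-reflexive (*-identityˡ (x ^ l)))))))
         (≈-trans (≈-*ˡ x q≈) (≈-reflexive (swap x l (x ^ suc l)))))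
    where
    swap : ∀ x l y → x * (l * y) ≡ l * (x * y)
    swap = solve-∀

-- For m = l k + r, `α e m` is the unit (δ e k)^l times `α e r` modulo `α e k`. As `α e r` is
-- smaller than `α e k`, divisibility forces it to vanish.
α∣α⇒∣ : ∀ e k m → 0 < k → α e k ∣ α e m → k ∣ m
α∣α⇒∣ e k m 0<k p = divides (m / k) (trans (m≡m%n+[m/n]*n m k) (cong (_+ m / k * k) r≡0))
  where
  instance
    k≢0 : NonZero k
    k≢0 = >-nonZero 0<k
  l = m / k
  r = m % k
  coarse : α e k ∣ α e (l * k)
  coarse = divides (proj₁ (α-quotient e k l 0<k)) (proj₁ (proj₂ (α-quotient e k l 0<k)))
  α≈ : α e m ≈ δ e k ^ l * α e r [ α e k ]
  α≈ = ≈-trans (≈-reflexive (cong (α e) (trans (m≡m%n+[m/n]*n m k) (+-comm r (l * k)))))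
    (≈-trans (≈-coarsen coarse (α-+≈ e (l * k) r)) (≈-*ʳ (α e r) (δ-*≈ e k l)))
  r≡0 : r ≡ 0
  r≡0 = α≡0 e r (∣-small (∣-cancel-unit {x = δ e k ^ l} (^²≈1 {δ e k} l (δ²≈1 e k)) (≈-∣ α≈ p)) (α-mono-< e (m%n<n m k)))

-- By `α-quotient`, α e (l k) divided by `α e k` is l times a unit modulo `α e k`, so a second
-- factor `α e k` can only come from l.
α²∣α⇒∣ : ∀ e k m → 0 < k → α e k * α e k ∣ α e m → α e k ∣ m
α²∣α⇒∣ e k m 0<k p = subst (α e k ∣_) (sym (_∣_.equality k∣m)) (∣m⇒∣m*n k u∣l)
  where
  instance
    u≢0 : NonZero (α e k)
    u≢0 = >-nonZero (≤-trans 0<k (n≤α e k))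
  k∣m : k ∣ m
  k∣m = α∣α⇒∣ e k m 0<k (∣-trans (m∣m*n (α e k)) p)
  l = quotient k∣m
  u∣l : α e k ∣ l
  u∣l =
    let q , q≡ , q≈ = α-quotient e k l 0<k
        u²∣qu = subst (α e k * α e k ∣_) (trans (cong (α e) (_∣_.equality k∣m)) q≡) p
    in ∣-cancel-unit {x = δ e k ^ suc l} (^²≈1 {δ e k} (suc l) (δ²≈1 e k))
         (subst (α e k ∣_) (*-comm l (δ e k ^ suc l)) (≈-∣ q≈ (*-cancelʳ-∣ (α e k) u²∣qu)))

α²∣α : ∀ e k → 0 < k → α e k * α e k ∣ α e (α e k * k)
α²∣α e k 0<k =
  let q , q≡ , q≈ = α-quotient e k (α e k) 0<k
  in subst (α e k * α e k ∣_) (sym q≡)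
       (*-monoˡ-∣ (α e k) (≈-∣ (≈-sym q≈) (m∣m*n (δ e k ^ suc (α e k)))))

-- The hypothesis says that v is the trace of the m-th power of the fundamental unit.
module _ (e m v : ℕ) (trace : v + e * α e m ≡ 2 * δ e m) where

  -- This identity and `α-antiperiodic` are instances of a (n + m) + a (n - m) = v a n, with a (-j)
  -- = -a j. Modulo v, the sequence is symmetric about m and changes sign under a shift by 2 m.
  α-reflect : ∀ i j → i + j ≡ m → α e (i + m) ≡ v * α e i + α e j
  α-reflect i j refl = by-adding 1 (α-+ e i (i + j)) (by-adding a (sym trace)
    (by-adding a (sym (δ-+ e i j)) (by-adding d (α-+ e i j) (by-adding p (pell e i)
      (identity e v a d p (δ e j) (α e (i + j)) (δ e (i + j)) (α e (i + (i + j))))))))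
    where
    a = α e i
    d = δ e i
    p = α e j
    identity : ∀ e v a d p q am dm c →
      c + 1 * (a * dm + d * am) + a * (v + e * am) + a * dm + d * (a * q + d * p) + p * (e * ((a + d) * a) + 1) ≡
      v * a + p + 1 * (c + e * (a * am)) + a * (2 * dm) + a * (d * q + e * (a * p)) + d * (am + e * (a * p)) + p * (d * d)
    identity = solve-∀

  α-antiperiodic : ∀ n → α e (n + m + m) + α e n ≡ v * α e (n + m)
  α-antiperiodic n = by-adding 1 (α-+ e (n + m) m) (by-adding a (δ-+ e n m)
    (by-adding b (sym trace) (by-adding d (sym (α-+ e n m)) (by-adding x (sym (pell e m))
      (identity e v a d x (δ e n) b (δ e (n + m)) (α e (n + m + m)))))))
    where
    a = α e m
    d = δ e m
    x = α e n
    b = α e (n + m)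
    identity : ∀ e v a d x y b bd c →
      c + x + 1 * (b * d + bd * a) + a * (y * d + e * (x * a)) + b * (v + e * a) + d * (b + e * (x * a)) + x * (d * d) ≡
      v * b + 1 * (c + e * (b * a)) + a * bd + b * (2 * d) + d * (x * d + y * a) + x * (e * ((a + d) * a) + 1)
    identity = solve-∀

-- Congruence up to sign

infix 4 _≈±_[_]

_≈±_[_] : ℕ → ℕ → ℕ → Set
a ≈± b [ m ] = a ≈ b [ m ] ⊎ a + b ≈ 0 [ m ]

≈±-trans : ∀ {a c m b} → a ≈ c [ m ] → c ≈± b [ m ] → a ≈± b [ m ]
≈±-trans p (inj₁ q) = inj₁ (≈-trans p q)
≈±-trans p (inj₂ q) = inj₂ (≈-trans (≈-+ p ≈-refl) q)

≈±-negate : ∀ {a c m b} → a + c ≈ 0 [ m ] → c ≈± b [ m ] → a ≈± b [ m ]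
≈±-negate p (inj₁ q) = inj₂ (≈-trans (≈-+ ≈-refl (≈-sym q)) p)
≈±-negate {a} {c} {m} {b} p (inj₂ q) = inj₁ (≈-cancelʳ (≈-trans p (≈-sym (≈-trans (≈-reflexive (+-comm b c)) q))) ≈-refl)

≈±-coarsen : ∀ {n m a b} → n ∣ m → a ≈± b [ m ] → a ≈± b [ n ]
≈±-coarsen p (inj₁ q) = inj₁ (≈-coarsen p q)
≈±-coarsen p (inj₂ q) = inj₂ (≈-coarsen p q)

≈±-unique : ∀ {a b m} → a ≈± b [ m ] → a + b < m → a ≡ b
≈±-unique {a} {b} (inj₁ p) a+b<m =
  ≈-unique p (≤-<-trans (m≤m+n a b) a+b<m) (≤-<-trans (m≤n+m b a) a+b<m)
≈±-unique {a} {b} (inj₂ p) a+b<m = trans (m+n≡0⇒m≡0 a sum≡0) (sym (m+n≡0⇒n≡0 a sum≡0))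
  where
  sum≡0 = ∣-small (≈0⇒∣ p) a+b<m

m+m≈0 : ∀ m → m + m ≈ 0 [ m ]
m+m≈0 m = mod 0 2 (trans (+-identityʳ (m + m)) (cong (m +_) (sym (+-identityʳ m))))

-- Reflection at m and the shift by 2 m fold every index into 0, ..., m. They change the value
-- modulo v and the index modulo m by at most a sign, and the two signs need not agree.
α-fold : ∀ e m v → v + e * α e m ≡ 2 * δ e m → 0 < m → ∀ n →
         ∃ λ j → j ≤ m × α e n ≈± α e j [ v ] × n ≈± j [ m ]
α-fold e m v trace 0<m = <-rec _ step
  where
  step : ∀ n → (∀ {k} → k < n → ∃ λ j → j ≤ m × α e k ≈± α e j [ v ] × k ≈± j [ m ]) →
         ∃ λ j → j ≤ m × α e n ≈± α e j [ v ] × n ≈± j [ m ]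
  step n rec with n ≤? m
  ... | yes n≤m = n , n≤m , inj₁ ≈-refl , inj₁ ≈-refl
  ... | no n≰m with m≤n⇒∃[o]m+o≡n (<⇒≤ (≰⇒> n≰m))
  ... | i , refl with i ≤? m
  ... | yes i≤m = j , j≤m , inj₁ α≈ , inj₂ (≈-trans (≈-reflexive index) (m+m≈0 m))
    where
    j = m ∸ i
    i+j≡m : i + j ≡ m
    i+j≡m = m+[n∸m]≡n i≤m
    j≤m = m∸n≤m m i
    index : m + i + j ≡ m + m
    index = trans (+-assoc m i j) (cong (m +_) i+j≡m)
    α≈ : α e (m + i) ≈ α e j [ v ]
    α≈ = ≈-trans (≈-reflexive (trans (cong (α e) (+-comm m i))
      (trans (α-reflect e m v trace i j i+j≡m) (trans (+-comm _ (α e j)) (cong (α e j +_) (*-comm v (α e i)))))))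
      (≈-drop (α e j) (α e i))
  ... | no i≰m with m≤n⇒∃[o]m+o≡n (<⇒≤ (≰⇒> i≰m))
  ... | k , refl =
    let j , j≤m , p , q = rec k<n
    in j , j≤m , ≈±-negate α≈ p , ≈±-trans k≈ q
    where
    reorder : m + (m + k) ≡ k + m + m
    reorder = trans (sym (+-assoc m m k)) (trans (+-comm (m + m) k) (sym (+-assoc k m m)))
    k<n : k < m + (m + k)
    k<n = subst (k <_) (+-assoc m m k) (m<n+m k (≤-trans 0<m (m≤m+n m m)))
    α≈ : α e (m + (m + k)) + α e k ≈ 0 [ v ]
    α≈ = ≈-trans (≈-reflexive (trans (cong (λ n → α e n + α e k) reorder) (α-antiperiodic e m v trace k)))
      (∣⇒≈0 (m∣m*n (α e (k + m))))
    k≈ : m + (m + k) ≈ k [ m ]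
    k≈ = ≈-trans (≈-reflexive (sym (+-assoc m m k))) (≈-+ (m+m≈0 m) (≈-refl {k}))

trace : ℕ → ℕ → ℕ
trace e zero = 2
trace e (suc m) = δ e (suc m) + δ e m

trace-equation : ∀ e m → trace e m + e * α e m ≡ 2 * δ e m
trace-equation e zero = cong (2 +_) (*-zeroʳ e)
trace-equation e (suc m) = identity e (δ e m) (α e (suc m))
  where
  identity : ∀ e d y → d + e * y + d + e * y ≡ 2 * (d + e * y)
  identity = solve-∀

-- Makes v large enough to separate, up to sign, the values `α e j` with j ≤ m.
2α<trace : ∀ e m → 2 ≤ e → 2 * α e m < trace e m
2α<trace e zero 2≤e = s≤s z≤n
2α<trace e (suc m) 2≤e = ≤-trans (s≤s (≤-trans (*-monoˡ-≤ (α e (suc m)) 2≤e) (m≤n+m _ (δ e m))))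
  (≤-trans (≤-reflexive (+-comm 1 _)) (+-monoʳ-≤ (δ e (suc m)) (0<δ e m)))

-- Here u = α e k, s = α e m with u ∣ m, and x = α w n. As w ≡ e modulo the trace v and
-- w ≡ 0 modulo u, x determines ± a modulo v and ± c modulo u, and a + c < u removes the sign.
record System (e c a : ℕ) : Set where
  field
    u du s ds v w x dx : ℕ
    pell-u : Pell e u du
    pell-s : Pell e s ds
    pell-x : Pell w x dx
    0<s    : 0 < s
    u²∣s   : u * u ∣ s
    v-trace : v + e * s ≡ 2 * ds
    w≈e    : w ≈ e [ v ]
    w≈0    : w ≈ 0 [ u ]
    a≈x    : a ≈ x [ v ]
    c≈x    : c ≈ x [ u ]
    small  : a + c < u

system-sound : ∀ {e c a} → 2 ≤ e → System e c a → a ≡ α e c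
system-sound {e} {c} {a} 2≤e S
  with pell-index e _ _ (System.pell-u S) | pell-index e _ _ (System.pell-s S) | pell-index _ _ _ (System.pell-x S)
... | k , u≡ , _ | m , s≡ , ds≡ | n , x≡ , _ = result
  where
  open System S
  0<u : 0 < u
  0<u = ≤-<-trans z≤n small
  0<k : 0 < k
  0<k = n≢0⇒n>0 λ { refl → contradiction u≡ (<⇒≢ 0<u ∘ sym) }
  0<m : 0 < m
  0<m = n≢0⇒n>0 λ { refl → contradiction s≡ (<⇒≢ 0<s ∘ sym) }
  v≡ : v + e * α e m ≡ 2 * δ e m
  v≡ = subst₂ (λ s ds → v + e * s ≡ 2 * ds) s≡ ds≡ v-trace
  v≡trace : v ≡ trace e m
  v≡trace = +-cancelʳ-≡ (e * α e m) v (trace e m) (trans v≡ (sym (trace-equation e m)))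
  -- The square in u² ∣ s is what reaches the index: a congruence of indices modulo m now survives
  -- modulo u.
  u∣m : u ∣ m
  u∣m = subst (_∣ m) (sym u≡) (α²∣α⇒∣ e k m 0<k (subst₂ (λ u s → u * u ∣ s) u≡ s≡ u²∣s))
  u≤s : u ≤ s
  u≤s = ∣⇒≤ {{>-nonZero 0<s}} (∣-trans (m∣m*n u) u²∣s)
  result : a ≡ α e c
  result with α-fold e m v v≡ 0<m n
  ... | j , j≤m , αn≈ , n≈ = trans a≡αj (cong (α e) (sym c≡j))
    where
    x≈αn : x ≈ α e n [ v ]
    x≈αn = ≈-trans (≈-reflexive x≡) (α-≈ n w≈e)
    x≈n : x ≈ n [ u ]
    x≈n = ≈-trans (≈-reflexive x≡) (≈-trans (α-≈ n w≈0) (≈-reflexive (α-zero n)))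
    a+αj<v : a + α e j < v
    a+αj<v = ≤-<-trans
      (+-mono-≤ (≤-trans (m≤m+n a c) (≤-trans (<⇒≤ small) u≤s)) (≤-trans (α-mono-≤ e j≤m) (≤-reflexive (sym s≡))))
      (subst₂ _<_ (trans (cong (α e m +_) (+-identityʳ (α e m))) (cong₂ _+_ (sym s≡) (sym s≡))) (sym v≡trace) (2α<trace e m 2≤e))
    -- Both a < u ≤ s and `α e j` are at most `α e m`, so their sum stays below v and excludes the
    -- negative sign.
    a≡αj : a ≡ α e j
    a≡αj = ≈±-unique (≈±-trans (≈-trans a≈x x≈αn) αn≈) a+αj<v
    -- Here j ≤ α e j = a, so c + j ≤ c + a < u and the sign is excluded again.
    c≡j : c ≡ j
    c≡j = ≈±-unique (≈±-trans (≈-trans c≈x x≈n) (≈±-coarsen u∣m n≈))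
      (≤-<-trans (+-monoʳ-≤ c (≤-trans (n≤α e j) (≤-reflexive (sym a≡αj)))) (subst (_< u) (+-comm a c) small))

data Parity : ℕ → Set where
  even : ∀ f → Parity (2 * f)
  odd  : ∀ f → Parity (1 + 2 * f)

parity : ∀ n → Parity n
parity zero = even 0
parity (suc n) with parity n
... | even f = odd f
... | odd f = subst Parity (identity f) (even (suc f))
  where
  identity : ∀ f → 2 * suc f ≡ suc (1 + 2 * f)
  identity = solve-∀

-- By the Pell equation `α e n` and `δ e n` are not both even, so `α e n` or their sum `α e (suc n)`
-- is odd. An odd u allows w to be solved for below.
odd-α : ∀ e n → ∃ λ k → n ≤ k × ∃ λ f → α e k ≡ 1 + 2 * f
odd-α e n with α e n in p | parity (α e n) | δ e n in q | parity (δ e n)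
... | y | odd f | d | _ = n , ≤-refl , f , p
... | y | even f | d | odd g = suc n , n≤1+n n , f + g , trans (cong₂ _+_ p q) (identity f g)
  where
  identity : ∀ f g → 2 * f + (1 + 2 * g) ≡ 1 + 2 * (f + g)
  identity = solve-∀
... | y | even f | d | even g = contradiction 2∣1 (>⇒∤ (s≤s (s≤s z≤n)))
  where
  2∣1 : 2 ∣ 1
  2∣1 = ∣m+n∣m⇒∣n
    (subst (2 ∣_) (subst₂ (Pell e) p q (pell e n)) (∣m⇒∣m*n (2 * g) (m∣m*n g)))
    (∣n⇒∣m*n e (∣n⇒∣m*n (2 * f + 2 * g) (m∣m*n f)))

system-complete : ∀ e c → System e c (α e c)
system-complete e c with odd-α e (suc (α e c + c))
... | k , a+c<k , f , u≡ = record
  { pell-u = pell e k ; pell-s = pell e m ; pell-x = pell w c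
  ; 0<s = ≤-trans (*-mono-≤ 0<u 0<k) (n≤α e m)
  ; u²∣s = u²∣s
  ; v-trace = trace-equation e m
  ; w≈e = w≈e
  ; w≈0 = w≈0
  ; a≈x = ≈-sym (α-≈ c w≈e)
  ; c≈x = ≈-trans (≈-reflexive (sym (α-zero c))) (≈-sym (α-≈ c w≈0))
  ; small = <-≤-trans a+c<k (n≤α e k)
  }
  where
  u = α e k
  m = u * k
  s = α e m
  ds = δ e m
  v = trace e m
  -- Modulo u the trace v is 2 ds, and ds² ≡ 1, so v f ds ≡ 2 f ≡ -1 because u = 1 + 2 f. Hence f ds
  -- is an inverse of -v and the added term cancels e.
  w = e + v * (f * ds * e)
  0<k : 0 < k
  0<k = ≤-trans (s≤s z≤n) a+c<k
  0<u : 0 < u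
  0<u = ≤-trans 0<k (n≤α e k)
  u²∣s : u * u ∣ s
  u²∣s = α²∣α e k 0<k
  u∣s : u ∣ s
  u∣s = ∣-trans (m∣m*n u) u²∣s
  w≈e : w ≈ e [ v ]
  w≈e = ≈-trans (≈-reflexive (cong (e +_) (*-comm v _))) (≈-drop e (f * ds * e))
  v≈2ds : v ≈ 2 * ds [ u ]
  v≈2ds = ≈-trans (≈-trans (≈-reflexive (sym (+-identityʳ v)))
    (≈-+ (≈-refl {v}) (≈-sym (∣⇒≈0 (∣n⇒∣m*n e u∣s))))) (≈-reflexive (trace-equation e m))
  w≈0 : w ≈ 0 [ u ]
  w≈0 = ≈-trans (≈-+ (≈-refl {e}) (≈-*ʳ (f * ds * e) v≈2ds))
    (≈-trans (≈-reflexive (regroup e f ds))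
    (≈-trans (≈-+ (≈-refl {e}) (≈-*ˡ (2 * f * e) (≈-coarsen u∣s (δ²≈1 e m))))
    (≈-trans (≈-reflexive (trans (collect e f) (cong (e *_) (sym u≡)))) (∣⇒≈0 (n∣m*n e)))))
    where
    regroup : ∀ e f d → e + 2 * d * (f * d * e) ≡ e + 2 * f * e * (d * d)
    regroup = solve-∀
    collect : ∀ e f → e + 2 * f * e * 1 ≡ e * (1 + 2 * f)
    collect = solve-∀

dio-pell : ∀ e y d → Dio (λ ν → Pell (ν e) (ν y) (ν d))
dio-pell e y d = dio-≡ (# d ⊗ # d) (# e ⊗ ((# y ⊕ # d) ⊗ # y) ⊕ con 1)

dio-α : ∀ t₀ t₁ t₂ → Dio (λ ν → 2 ≤ eval t₀ ν × eval t₂ ν ≡ α (eval t₀ ν) (eval t₁ ν))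
dio-α t₀ t₁ t₂ = dio-app
  (dio-⇔ {T = λ ν → 2 ≤ ν 0 × ν 2 ≡ α (ν 0) (ν 1)}
    (λ ν → 2 ≤ ν 0 × Σ ℕ λ u → Σ ℕ λ du → Σ ℕ λ s → Σ ℕ λ ds → Σ ℕ λ v → Σ ℕ λ w → Σ ℕ λ x → Σ ℕ λ dx →
      Pell (ν 0) u du × Pell (ν 0) s ds × Pell w x dx × 0 < s × u * u ∣ s × v + ν 0 * s ≡ 2 * ds ×
      w ≈ ν 0 [ v ] × w ≈ 0 [ u ] × ν 2 ≈ x [ v ] × ν 1 ≈ x [ u ] × ν 2 + ν 1 < u)
    (dio-≤ (con 2) (# 0) ∧ᴰ
      dio-∃ (dio-∃ (dio-∃ (dio-∃ (dio-∃ (dio-∃ (dio-∃ (dio-∃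
        (dio-pell 8 7 6 ∧ᴰ dio-pell 8 5 4 ∧ᴰ dio-pell 2 1 0 ∧ᴰ dio-< (con 0) (# 5) ∧ᴰ dio-∣ (# 7 ⊗ # 7) (# 5) ∧ᴰ
         dio-≡ (# 3 ⊕ # 8 ⊗ # 5) (con 2 ⊗ # 4) ∧ᴰ dio-≈ (# 2) (# 8) (# 3) ∧ᴰ dio-≈ (# 2) (con 0) (# 7) ∧ᴰ
         dio-≈ (# 10) (# 1) (# 3) ∧ᴰ dio-≈ (# 9) (# 1) (# 7) ∧ᴰ dio-< (# 10 ⊕ # 9) (# 7))))))))))
    (λ ν → mk⇔
      (λ (2≤e , u , du , s , ds , v , w , x , dx , p₁ , p₂ , p₃ , p₄ , p₅ , p₆ , p₇ , p₈ , p₉ , p₁₀ , p₁₁) →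
        2≤e , system-sound 2≤e (record
          { pell-u = p₁ ; pell-s = p₂ ; pell-x = p₃ ; 0<s = p₄ ; u²∣s = p₅ ; v-trace = p₆
          ; w≈e = p₇ ; w≈0 = p₈ ; a≈x = p₉ ; c≈x = p₁₀ ; small = p₁₁ }))
      (λ (2≤e , a≡) →
        let open System (subst (System (ν 0) (ν 1)) (sym a≡) (system-complete (ν 0) (ν 1)))
        in 2≤e , u , du , s , ds , v , w , x , dx ,
           pell-u , pell-s , pell-x , 0<s , u²∣s , v-trace , w≈e , w≈0 , a≈x , c≈x , small)))
  (t₀ ∷ t₁ ∷ t₂ ∷ [])

-- Exponentials, binomial coefficients and factorials

-- The modulus is (q + 1)(d + 1) - 1. Modulo it, q + 1 is a root of X² - (q + d + 2) X + 1, the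
-- characteristic polynomial for e = q + d, and θ becomes -d.
power-≈ : ∀ q d n → suc q ^ n + d * α (q + d) n ≈ δ (q + d) n [ q * d + (q + d) ]
power-≈ q d zero = ≈-reflexive (cong suc (*-zeroʳ d))
power-≈ q d (suc n) = ≈-trans
  (≈-sym (≈-trans (≈-reflexive (identity q d (suc q ^ n) y z)) (≈-drop (suc q * suc q ^ n + d * (y + z)) y)))
  (≈-trans (≈-+ (≈-*ˡ (suc q) (power-≈ q d n)) (≈-refl {q * y + d * (y + z)}))
    (≈-reflexive (sym (split q d y z))))
  where
  y = α (q + d) n
  z = δ (q + d) n
  identity : ∀ q d p y z → suc q * (p + d * y) + (q * y + d * (y + z)) ≡ suc q * p + d * (y + z) + y * (q * d + (q + d))
  identity = solve-∀
  split : ∀ q d y z → z + (q + d) * (y + z) ≡ suc q * z + (q * y + d * (y + z))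
  split = solve-∀

power-≤ : ∀ e n → suc e ^ n ≤ α e (suc n)
power-≤ e zero = ≤-refl
power-≤ e (suc n) = ≤-trans (*-monoʳ-≤ (suc e) (power-≤ e n))
  (+-monoʳ-≤ (α e (suc n)) (m≤n+m (e * α e (suc n)) (δ e n)))

-- Modulo q d + q + d, the power (q + 1)ⁿ is an integral combination of a = α (q + d) n and
-- a′ = α (q + d) (n + 1); h certifies that the modulus is large enough.
PowerSystem : ℕ → ℕ → ℕ → Set
PowerSystem q n y = Σ ℕ λ d → Σ ℕ λ a → Σ ℕ λ a′ → Σ ℕ λ h →
  (2 ≤ q + d × a ≡ α (q + d) n) × (2 ≤ q + d × a′ ≡ α (q + d) (1 + n)) × (2 ≤ q + 2 × h ≡ α (q + 2) (1 + n)) ×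
  h < q * d + (q + d) × y < q * d + (q + d) × y + d * a + a ≈ a′ [ q * d + (q + d) ]

-- The parameter q + 2, instead of q, meets the requirement 2 ≤ e of `dio-α` for every q.
power-bound : ∀ q n m → α (q + 2) (1 + n) < m → suc q ^ n < m
power-bound q n m = ≤-<-trans (≤-trans (^-monoˡ-≤ n (s≤s (m≤m+n q 2))) (power-≤ (q + 2) n))

power-≈′ : ∀ q d n → suc q ^ n + d * α (q + d) n + α (q + d) n ≈ α (q + d) (1 + n) [ q * d + (q + d) ]
power-≈′ q d n = ≈-trans (≈-+ (power-≈ q d n) ≈-refl) (≈-reflexive (+-comm (δ (q + d) n) (α (q + d) n)))

power-sound : ∀ q n y → PowerSystem q n y → y ≡ suc q ^ n
power-sound q n y (d , _ , _ , _ , (_ , refl) , (_ , refl) , (_ , refl) , h<m , y<m , y≈) = ≈-unique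
  (≈-cancelʳ (≈-cancelʳ (≈-trans y≈ (≈-sym (power-≈′ q d n))) ≈-refl) ≈-refl) y<m (power-bound q n _ h<m)

power-complete : ∀ q n y → y ≡ suc q ^ n → PowerSystem q n y
power-complete q n _ refl =
  d , α (q + d) n , α (q + d) (1 + n) , h , (2≤e , refl) , (2≤e , refl) , (m≤n+m 2 q , refl) ,
  h<m , power-bound q n _ h<m , power-≈′ q d n
  where
  h = α (q + 2) (1 + n)
  d = 2 + h
  2≤e : 2 ≤ q + d
  2≤e = ≤-trans (s≤s (s≤s z≤n)) (m≤n+m d q)
  h<m : h < q * d + (q + d)
  h<m = ≤-trans (n≤1+n (suc h)) (≤-trans (m≤n+m d q) (m≤n+m (q + d) (q * d)))

dio-^ : ∀ t₀ t₁ t₂ → Dio (λ ν → eval t₂ ν ≡ suc (eval t₀ ν) ^ eval t₁ ν)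
dio-^ t₀ t₁ t₂ = dio-app
  (dio-⇔ {T = λ ν → ν 2 ≡ suc (ν 0) ^ ν 1} (λ ν → PowerSystem (ν 0) (ν 1) (ν 2))
    (dio-∃ (dio-∃ (dio-∃ (dio-∃
      (dio-α (# 4 ⊕ # 3) (# 5) (# 2) ∧ᴰ dio-α (# 4 ⊕ # 3) (con 1 ⊕ # 5) (# 1) ∧ᴰ dio-α (# 4 ⊕ con 2) (con 1 ⊕ # 5) (# 0) ∧ᴰ
       dio-< (# 0) modulus ∧ᴰ dio-< (# 6) modulus ∧ᴰ dio-≈ (# 6 ⊕ # 3 ⊗ # 2 ⊕ # 2) (# 1) modulus)))))
    (λ ν → mk⇔ (power-sound (ν 0) (ν 1) (ν 2)) (power-complete (ν 0) (ν 1) (ν 2))))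
  (t₀ ∷ t₁ ∷ t₂ ∷ [])
  where
  modulus = # 4 ⊗ # 3 ⊕ (# 4 ⊕ # 3)

nC0≡1 : ∀ n → n C 0 ≡ 1
nC0≡1 n = trans (nCk≡nC[n∸k] {0} {n} z≤n) (nCn≡1 n)

nCk≤2^n : ∀ n k → n C k ≤ 2 ^ n
nCk≤2^n n zero = ≤-trans (≤-reflexive (nC0≡1 n)) (m^n>0 2 n)
nCk≤2^n zero (suc k) = ≤-trans (≤-reflexive (k>n⇒nCk≡0 {0} {suc k} (s≤s z≤n))) z≤n
nCk≤2^n (suc n) (suc k) = ≤-trans (≤-reflexive (sym (nCk+nC[k+1]≡[n+1]C[k+1] n k)))
  (+-mono-≤ (nCk≤2^n n k) (≤-trans (nCk≤2^n n (suc k)) (≤-reflexive (sym (+-identityʳ (2 ^ n))))))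

[1+k]*[1+n]C[1+k]≡[1+n]*nCk : ∀ n k → suc k * (suc n C suc k) ≡ suc n * (n C k)
[1+k]*[1+n]C[1+k]≡[1+n]*nCk n zero = trans (*-identityˡ (suc n C 1)) (trans (nC1≡n (suc n))
  (sym (trans (cong (suc n *_) (nC0≡1 n)) (*-identityʳ (suc n)))))
[1+k]*[1+n]C[1+k]≡[1+n]*nCk zero (suc k) = trans
  (cong (suc (suc k) *_) (k>n⇒nCk≡0 {1} {suc (suc k)} (s≤s (s≤s z≤n))))
  (trans (*-zeroʳ (suc (suc k))) (sym (trans (*-identityˡ (0 C suc k)) (k>n⇒nCk≡0 {0} {suc k} (s≤s z≤n)))))
[1+k]*[1+n]C[1+k]≡[1+n]*nCk (suc n) (suc k) = begin
  suc (suc k) * (suc (suc n) C suc (suc k))                  ≡⟨ cong (suc (suc k) *_) (sym (nCk+nC[k+1]≡[n+1]C[k+1] (suc n) (suc k))) ⟩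
  suc (suc k) * (p + suc n C suc (suc k))                    ≡⟨ split k p (suc n C suc (suc k)) ⟩
  p + (suc k * p + suc (suc k) * (suc n C suc (suc k)))      ≡⟨ cong (p +_) (cong₂ _+_ ([1+k]*[1+n]C[1+k]≡[1+n]*nCk n k) ([1+k]*[1+n]C[1+k]≡[1+n]*nCk n (suc k))) ⟩
  p + (suc n * (n C k) + suc n * (n C suc k))                ≡⟨ cong (p +_) (sym (*-distribˡ-+ (suc n) (n C k) (n C suc k))) ⟩
  p + suc n * (n C k + n C suc k)                            ≡⟨ cong (λ z → p + suc n * z) (nCk+nC[k+1]≡[n+1]C[k+1] n k) ⟩
  suc (suc n) * p                                            ∎
  where
  open ≡-Reasoning
  p = suc n C suc k
  split : ∀ k p q → suc (suc k) * (p + q) ≡ p + (suc k * p + suc (suc k) * q)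
  split = solve-∀

lowDigits : ℕ → ℕ → ℕ → ℕ
lowDigits b n zero = 0
lowDigits b n (suc k) = lowDigits b n k + (n C k) * b ^ k

lowDigits-zero : ∀ b k → lowDigits b 0 (suc k) ≡ 1
lowDigits-zero b zero = refl
lowDigits-zero b (suc k) = trans (cong₂ _+_ (lowDigits-zero b k) (cong (_* b ^ suc k) (k>n⇒nCk≡0 {0} {suc k} (s≤s z≤n)))) refl

-- Pascal's rule under multiplication by b + 1; the extra term is what crosses the truncation.
lowDigits-suc : ∀ b n k → suc b * lowDigits b n (suc k) ≡ lowDigits b (suc n) (suc k) + (n C k) * b ^ suc k
lowDigits-suc b n zero = trans (cong (λ z → suc b * (z * 1)) (nC0≡1 n)) (trans (identity b)
  (sym (cong₂ (λ y z → y * 1 + z * (b * 1)) (nC0≡1 (suc n)) (nC0≡1 n))))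
  where
  identity : ∀ b → suc b * (1 * 1) ≡ 1 * 1 + 1 * (b * 1)
  identity = solve-∀
lowDigits-suc b n (suc k) = trans (*-distribˡ-+ (suc b) (lowDigits b n (suc k)) _)
  (trans (cong (_+ suc b * ((n C suc k) * b ^ suc k)) (lowDigits-suc b n k))
  (trans (identity (lowDigits b (suc n) (suc k)) (n C k) (n C suc k) b (b ^ k))
    (cong (λ z → lowDigits b (suc n) (suc k) + z * b ^ suc k + (n C suc k) * b ^ suc (suc k)) (nCk+nC[k+1]≡[n+1]C[k+1] n k))))
  where
  identity : ∀ l c c′ b p → l + c * (b * p) + suc b * (c′ * (b * p)) ≡ l + (c + c′) * (b * p) + c′ * (b * (b * p))
  identity = solve-∀

lowDigits-remainder : ∀ b n k → ∃ λ h → suc b ^ n ≡ lowDigits b n k + h * b ^ k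
lowDigits-remainder b n zero = suc b ^ n , sym (*-identityʳ _)
lowDigits-remainder b zero (suc k) = 0 , sym (trans (+-identityʳ _) (lowDigits-zero b k))
lowDigits-remainder b (suc n) (suc k) =
  let h , p = lowDigits-remainder b n (suc k)
  in suc b * h + n C k ,
     trans (cong (suc b *_) p) (trans (*-distribˡ-+ (suc b) (lowDigits b n (suc k)) (h * b ^ suc k))
       (trans (cong (_+ suc b * (h * b ^ suc k)) (lowDigits-suc b n k))
         (identity (lowDigits b (suc n) (suc k)) (n C k) (b ^ suc k) b h)))
  where
  identity : ∀ l c p b h → l + c * p + suc b * (h * p) ≡ l + (suc b * h + c) * p
  identity = solve-∀

-- Each coefficient is at most 2ⁿ, hence a genuine digit in base b.
lowDigits-< : ∀ b n k → 2 ^ n < b → lowDigits b n k < b ^ k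
lowDigits-< b n zero 2^n<b = s≤s z≤n
lowDigits-< b n (suc k) 2^n<b = <-≤-trans (+-monoˡ-< _ (lowDigits-< b n k 2^n<b))
  (*-monoˡ-≤ (b ^ k) (≤-trans (s≤s (nCk≤2^n n k)) 2^n<b))

-- y is the digit at position k of (b + 1)ⁿ in base b = t + 1.
BinomialSystem : ℕ → ℕ → ℕ → Set
BinomialSystem n k y = Σ ℕ λ t → Σ ℕ λ p → Σ ℕ λ q → Σ ℕ λ h → Σ ℕ λ v →
  t ≡ 2 ^ n × p ≡ suc t ^ k × q ≡ suc (suc t) ^ n × q ≡ v + (y + h * suc t) * p × v < p × y < suc t

binomial-expansion : ∀ n k → ∃ λ h → suc (suc (2 ^ n)) ^ n ≡
  lowDigits (suc (2 ^ n)) n k + (n C k + h * suc (2 ^ n)) * suc (2 ^ n) ^ k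
binomial-expansion n k =
  let b = suc (2 ^ n)
      h , p = lowDigits-remainder b n (suc k)
  in h , trans p (identity (lowDigits b n k) (n C k) b (b ^ k) h)
  where
  identity : ∀ l c b p h → l + c * p + h * (b * p) ≡ l + (c + h * b) * p
  identity = solve-∀

binomial-sound : ∀ n k y → BinomialSystem n k y → y ≡ n C k
binomial-sound n k y (_ , _ , _ , h , v , refl , refl , refl , q≡ , v<p , y<b) =
  ≈-unique (≈-trans (≈-sym (≈-drop y h)) (≈-trans (≈-reflexive digits≡) (≈-drop (n C k) h′))) y<b (s≤s (nCk≤2^n n k))
  where
  b = suc (2 ^ n)
  l = lowDigits b n k
  h′ = proj₁ (binomial-expansion n k)
  expansions≡ : v + (y + h * b) * b ^ k ≡ l + (n C k + h′ * b) * b ^ k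
  expansions≡ = trans (sym q≡) (proj₂ (binomial-expansion n k))
  v≡l : v ≡ l
  v≡l = ≈-unique (mod (y + h * b) (n C k + h′ * b) expansions≡) v<p (lowDigits-< b n k ≤-refl)
  digits≡ : y + h * b ≡ n C k + h′ * b
  digits≡ = *-cancelʳ-≡ _ _ (b ^ k) {{m^n≢0 b k}} (+-cancelˡ-≡ l _ _ (trans (cong (_+ (y + h * b) * b ^ k) (sym v≡l)) expansions≡))

binomial-complete : ∀ n k y → y ≡ n C k → BinomialSystem n k y
binomial-complete n k _ refl =
  let h , p = binomial-expansion n k
  in 2 ^ n , _ , _ , h , lowDigits (suc (2 ^ n)) n k , refl , refl , refl , p , lowDigits-< _ n k ≤-refl , s≤s (nCk≤2^n n k)

dio-C : ∀ t₀ t₁ t₂ → Dio (λ ν → eval t₂ ν ≡ eval t₀ ν C eval t₁ ν)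
dio-C t₀ t₁ t₂ = dio-app
  (dio-⇔ {T = λ ν → ν 2 ≡ ν 0 C ν 1} (λ ν → BinomialSystem (ν 0) (ν 1) (ν 2))
    (dio-∃ (dio-∃ (dio-∃ (dio-∃ (dio-∃
      (dio-^ (con 1) (# 5) (# 4) ∧ᴰ dio-^ (# 4) (# 6) (# 3) ∧ᴰ dio-^ (con 1 ⊕ # 4) (# 5) (# 2) ∧ᴰ
       dio-≡ (# 2) (# 0 ⊕ (# 7 ⊕ # 1 ⊗ (con 1 ⊕ # 4)) ⊗ # 3) ∧ᴰ dio-< (# 0) (# 3) ∧ᴰ dio-< (# 7) (con 1 ⊕ # 4)))))))
    (λ ν → mk⇔ (binomial-sound (ν 0) (ν 1) (ν 2)) (binomial-complete (ν 0) (ν 1) (ν 2))))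
  (t₀ ∷ t₁ ∷ t₂ ∷ [])

-- Products of arithmetic progressions

∏ : ℕ → ℕ → ℕ → ℕ
∏ x d zero = 1
∏ x d (suc n) = ∏ x d n * (x + n * d)

∏-rising : ∀ r n → ∏ (suc r) 1 n ≡ n ! * ((r + n) C n)
∏-rising r zero = sym (cong (1 *_) (nC0≡1 (r + 0)))
∏-rising r (suc n) = begin
  ∏ (suc r) 1 n * (suc r + n * 1)                  ≡⟨ cong₂ (λ y z → y * (suc r + z)) (∏-rising r n) (*-identityʳ n) ⟩
  n ! * ((r + n) C n) * suc (r + n)                ≡⟨ *-assoc (n !) _ _ ⟩
  n ! * (((r + n) C n) * suc (r + n))              ≡⟨ cong (n ! *_) (*-comm ((r + n) C n) (suc (r + n))) ⟩
  n ! * (suc (r + n) * ((r + n) C n))              ≡⟨ cong (n ! *_) (sym ([1+k]*[1+n]C[1+k]≡[1+n]*nCk (r + n) n)) ⟩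
  n ! * (suc n * (suc (r + n) C suc n))            ≡⟨ sym (*-assoc (n !) (suc n) _) ⟩
  n ! * suc n * (suc (r + n) C suc n)              ≡⟨ cong₂ (λ y z → y * (z C suc n)) (*-comm (n !) (suc n)) (sym (+-suc r n)) ⟩
  suc n ! * ((r + suc n) C suc n)                  ∎
  where open ≡-Reasoning

^≤∏-rising : ∀ r n → suc r ^ n ≤ ∏ (suc r) 1 n
^≤∏-rising r zero = ≤-refl
^≤∏-rising r (suc n) = ≤-trans (≤-reflexive (*-comm (suc r) (suc r ^ n)))
  (*-mono-≤ (^≤∏-rising r n) (m≤m+n (suc r) (n * 1)))

-- Divided by k rⁿ: the product of 1 + j / r over j < n is at most 1 + (2ⁿ - 1) / k once r ≥ n k.
∏-rising≤ : ∀ k r n → 0 < k → n * k ≤ r → k * ∏ r 1 n + r ^ n ≤ r ^ n * (k + 2 ^ n)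
∏-rising≤ k r zero 0<k nk≤r = ≤-reflexive (identity k)
  where
  identity : ∀ k → k * 1 + 1 ≡ 1 * (k + 1)
  identity = solve-∀
∏-rising≤ k@(suc h) r (suc n) 0<k nk≤r = +-cancelʳ-≤ (n * p) _ _ (begin
  k * (∏ r 1 n * (r + n * 1)) + r * p + n * p   ≡⟨ expand k (∏ r 1 n) r n p ⟩
  (k * ∏ r 1 n + p) * (r + n)                   ≤⟨ *-monoˡ-≤ (r + n) (∏-rising≤ k r n 0<k (≤-trans (m≤n+m (n * k) k) nk≤r)) ⟩
  p * (k + t) * (r + n)                         ≡⟨ distribute p k t r n ⟩
  p * (r * (k + t)) + p * (n * (k + t))         ≤⟨ +-monoʳ-≤ (p * (r * (k + t))) (*-monoʳ-≤ p excess) ⟩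
  p * (r * (k + t)) + p * (r * t + n)           ≡⟨ collect p k t r n ⟩
  r * p * (k + 2 * t) + n * p                   ∎)
  where
  open ≤-Reasoning
  p = r ^ n
  t = 2 ^ n
  expand : ∀ k q r n p → k * (q * (r + n * 1)) + r * p + n * p ≡ (k * q + p) * (r + n)
  expand = solve-∀
  distribute : ∀ p k t r n → p * (k + t) * (r + n) ≡ p * (r * (k + t)) + p * (n * (k + t))
  distribute = solve-∀
  collect : ∀ p k t r n → p * (r * (k + t)) + p * (r * t + n) ≡ r * p * (k + 2 * t) + n * p
  collect = solve-∀
  -- This is (k - 1)(t - 1) ≥ 0.
  k+t≤kt+1 : k + t ≤ k * t + 1
  k+t≤kt+1 = begin
    suc h + t          ≡⟨ cong (_+ t) (+-comm 1 h) ⟩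
    h + 1 + t          ≤⟨ +-monoˡ-≤ t (+-monoˡ-≤ 1 (m≤m*n h t {{m^n≢0 2 n}})) ⟩
    h * t + 1 + t      ≡⟨ trans (+-comm _ t) (sym (+-assoc t (h * t) 1)) ⟩
    suc h * t + 1      ∎
  excess : n * (k + t) ≤ r * t + n
  excess = begin
    n * (k + t)       ≤⟨ *-monoʳ-≤ n k+t≤kt+1 ⟩
    n * (k * t + 1)   ≡⟨ trans (*-distribˡ-+ n (k * t) 1) (cong₂ _+_ (sym (*-assoc n k t)) (*-identityʳ n)) ⟩
    n * k * t + n     ≤⟨ +-monoˡ-≤ n (*-monoˡ-≤ t (≤-trans (m≤n+m (n * k) k) nk≤r)) ⟩
    r * t + n         ∎

-- Taking k = n! 2ⁿ in `∏-rising≤` brings the product divided by (r + 1)ⁿ below 1 + 1 / n!.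
∏-rising< : ∀ r n → n * (n ! * 2 ^ n) ≤ suc r → n ! * ∏ (suc r) 1 n < n ! * suc r ^ n + suc r ^ n
∏-rising< r n bound = *-cancelˡ-< t _ _ (begin-strict
  t * (n ! * q)                   ≡⟨ regroup t (n !) q ⟩
  n ! * t * q                     <⟨ m<m+n _ (m^n>0 (suc r) n) ⟩
  n ! * t * q + p                 ≤⟨ ∏-rising≤ (n ! * t) (suc r) n (*-mono-≤ (1≤n! n) (m^n>0 2 n)) bound ⟩
  p * (n ! * t + t)               ≡⟨ collect p (n !) t ⟩
  t * (n ! * p + p)               ∎)
  where
  open ≤-Reasoning
  p = suc r ^ n
  q = ∏ (suc r) 1 n
  t = 2 ^ n
  regroup : ∀ t f q → t * (f * q) ≡ f * t * q
  regroup = solve-∀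
  collect : ∀ p f t → p * (f * t + t) ≡ t * (f * p + p)
  collect = solve-∀

-- Bounds n! 2ⁿ by a power, so that a large enough r can be named before factorials are known to be
-- Diophantine.
!*2^≤ : ∀ n k → k ≤ n → k ! * 2 ^ k ≤ suc (suc (2 * n)) ^ k
!*2^≤ n zero k≤n = ≤-refl
!*2^≤ n (suc k) k<n = ≤-trans (≤-reflexive (regroup k (k !) (2 ^ k)))
  (*-mono-≤ (≤-trans (*-monoʳ-≤ 2 k<n) (≤-trans (n≤1+n _) (n≤1+n _))) (!*2^≤ n k (<⇒≤ k<n)))
  where
  regroup : ∀ k f t → suc k * f * (2 * t) ≡ 2 * suc k * (f * t)
  regroup = solve-∀

-- n! is the quotient, rounded up, of (r + 1)ⁿ by C (r + n) n for all large r.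
FactorialSystem : ℕ → ℕ → Set
FactorialSystem n y = Σ ℕ λ w → Σ ℕ λ c → Σ ℕ λ p →
  w ≡ suc (1 + 2 * n) ^ n × c ≡ (n * w + n) C n × p ≡ suc (n * w) ^ n × p ≤ y * c × y * c < p + c

-- n! c is the rising product, which exceeds p by less than p / n!, and p / n! is at most c.
factorial-bounds : ∀ n →
  let r = n * suc (1 + 2 * n) ^ n ; c = (r + n) C n in suc r ^ n ≤ n ! * c × n ! * c < suc r ^ n + c
factorial-bounds n = p≤ , subst (_< p + c) (∏-rising r n) (*-cancelˡ-< (n !) _ _ (begin-strict
  n ! * ∏ (suc r) 1 n     <⟨ ∏-rising< r n (≤-trans (*-monoʳ-≤ n (!*2^≤ n n ≤-refl)) (n≤1+n r)) ⟩
  n ! * p + p             ≤⟨ +-monoʳ-≤ (n ! * p) p≤ ⟩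
  n ! * p + n ! * c       ≡⟨ sym (*-distribˡ-+ (n !) p c) ⟩
  n ! * (p + c)           ∎))
  where
  open ≤-Reasoning
  r = n * suc (1 + 2 * n) ^ n
  c = (r + n) C n
  p = suc r ^ n
  p≤ : p ≤ n ! * c
  p≤ = subst (p ≤_) (∏-rising r n) (^≤∏-rising r n)

factorial-sound : ∀ n y → FactorialSystem n y → y ≡ n !
factorial-sound n y (_ , c , p , refl , refl , refl , p≤yc , yc<) =
  ≤-antisym (quotient-≤ y (n !) (proj₁ (factorial-bounds n)) yc<) (quotient-≤ (n !) y p≤yc (proj₂ (factorial-bounds n)))
  where
  quotient-≤ : ∀ y z → p ≤ z * c → y * c < p + c → y ≤ z
  quotient-≤ y z p≤zc yc< = ≤-pred (*-cancelʳ-< c y (suc z)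
    (<-≤-trans yc< (≤-trans (+-monoˡ-≤ c p≤zc) (≤-reflexive (+-comm (z * c) c)))))

factorial-complete : ∀ n y → y ≡ n ! → FactorialSystem n y
factorial-complete n _ refl = _ , _ , _ , refl , refl , refl , factorial-bounds n

dio-! : ∀ t₀ t₁ → Dio (λ ν → eval t₁ ν ≡ eval t₀ ν !)
dio-! t₀ t₁ = dio-app
  (dio-⇔ {T = λ ν → ν 1 ≡ ν 0 !} (λ ν → FactorialSystem (ν 0) (ν 1))
    (dio-∃ (dio-∃ (dio-∃
      (dio-^ (con 1 ⊕ con 2 ⊗ # 3) (# 3) (# 2) ∧ᴰ dio-C (# 3 ⊗ # 2 ⊕ # 3) (# 3) (# 1) ∧ᴰ dio-^ (# 3 ⊗ # 2) (# 3) (# 0) ∧ᴰ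
       dio-≤ (# 0) (# 4 ⊗ # 1) ∧ᴰ dio-< (# 4 ⊗ # 1) (# 0 ⊕ # 1)))))
    (λ ν → mk⇔ (factorial-sound (ν 0) (ν 1)) (factorial-complete (ν 0) (ν 1))))
  (t₀ ∷ t₁ ∷ [])

∏-≈ : ∀ {x y m} d n → x ≈ y [ m ] → ∏ x d n ≈ ∏ y d n [ m ]
∏-≈ d zero p = ≈-refl
∏-≈ d (suc n) p = ≈-* (∏-≈ d n p) (≈-+ p ≈-refl)

∏-scale : ∀ d x n → ∏ (d * x) d n ≡ d ^ n * ∏ x 1 n
∏-scale d x zero = refl
∏-scale d x (suc n) = trans (cong (_* (d * x + n * d)) (∏-scale d x n)) (identity d x n (d ^ n) (∏ x 1 n))
  where
  identity : ∀ d x n p q → p * q * (d * x + n * d) ≡ d * p * (q * (x + n * 1))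
  identity = solve-∀

∏≤^ : ∀ x d n k → k ≤ n → ∏ x d k ≤ suc (x + d * n) ^ k
∏≤^ x d n zero k≤n = ≤-refl
∏≤^ x d n (suc k) k<n = ≤-trans (≤-reflexive (*-comm (∏ x d k) (x + k * d)))
  (*-mono-≤ (≤-trans (+-monoʳ-≤ x (≤-trans (≤-reflexive (*-comm k d)) (*-monoʳ-≤ d (<⇒≤ k<n)))) (n≤1+n _))
    (∏≤^ x d n k (<⇒≤ k<n)))

-- Modulo d k + 1, d is invertible and the progression is d times one of difference 1.
ProductSystem : ℕ → ℕ → ℕ → ℕ → Set
ProductSystem x d n y = 0 < d × Σ ℕ λ k → Σ ℕ λ q → Σ ℕ λ p → Σ ℕ λ f → Σ ℕ λ c →
  k ≡ suc (x + d * n) ^ n × (Σ ℕ λ d′ → d ≡ suc d′ × p ≡ suc d′ ^ n) × f ≡ n ! × c ≡ (q + n) C n ×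
  d * suc q ≈ x [ 1 + d * k ] × y < 1 + d * k × y ≈ p * (f * c) [ 1 + d * k ]

∏-reduction : ∀ x d n q m → d * suc q ≈ x [ m ] → ∏ x d n ≈ d ^ n * (n ! * ((q + n) C n)) [ m ]
∏-reduction x d n q m dq≈x = ≈-trans (∏-≈ d n (≈-sym dq≈x))
  (≈-reflexive (trans (∏-scale d (suc q) n) (cong (d ^ n *_) (∏-rising q n))))

∏-bound : ∀ x d n → 0 < d → ∏ x d n < 1 + d * suc (x + d * n) ^ n
∏-bound x d n 0<d = s≤s (≤-trans (∏≤^ x d n n ≤-refl) (m≤n*m _ d {{>-nonZero 0<d}}))

product-sound : ∀ x d n y → ProductSystem x d n y → 0 < d × y ≡ ∏ x d n
product-sound x _ n y (0<d , _ , q , _ , _ , _ , refl , (d′ , refl , refl) , refl , refl , dq≈x , y<m , y≈) =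
  0<d , ≈-unique (≈-trans y≈ (≈-sym (∏-reduction x (suc d′) n q _ dq≈x))) y<m (∏-bound x (suc d′) n 0<d)

product-complete : ∀ x d n y → 0 < d × y ≡ ∏ x d n → ProductSystem x d n y
product-complete x d@(suc d′) n _ (0<d , refl) =
  0<d , k , q , _ , _ , _ , refl , (d′ , refl , refl) , refl , refl , dq≈x , ∏-bound x d n 0<d , ∏-reduction x d n q _ dq≈x
  where
  k = suc (x + d * n) ^ n
  -- As d k ≡ -1, an inverse of d is k (d k). So q + 1 is x times this inverse, plus the modulus 1 +
  -- d k to keep it positive.
  q = x * k * (d * k) + d * k
  dq≈x : d * suc q ≈ x [ 1 + d * k ]
  dq≈x = mod x (x * (d * k) + d) (identity x d k)
    where
    identity : ∀ x d k → d * suc (x * k * (d * k) + d * k) + x * (1 + d * k) ≡ x + (x * (d * k) + d) * (1 + d * k)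
    identity = solve-∀

dio-∏ : ∀ t₀ t₁ t₂ t₃ → Dio (λ ν → 0 < eval t₁ ν × eval t₃ ν ≡ ∏ (eval t₀ ν) (eval t₁ ν) (eval t₂ ν))
dio-∏ t₀ t₁ t₂ t₃ = dio-app
  (dio-⇔ {T = λ ν → 0 < ν 1 × ν 3 ≡ ∏ (ν 0) (ν 1) (ν 2)} (λ ν → ProductSystem (ν 0) (ν 1) (ν 2) (ν 3))
    (dio-< (con 0) (# 1) ∧ᴰ
     dio-∃ (dio-∃ (dio-∃ (dio-∃ (dio-∃
       (dio-^ (# 5 ⊕ # 6 ⊗ # 7) (# 7) (# 4) ∧ᴰ
        dio-∃ (dio-≡ (# 7) (con 1 ⊕ # 0) ∧ᴰ dio-^ (# 0) (# 8) (# 3)) ∧ᴰ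
        dio-! (# 7) (# 1) ∧ᴰ dio-C (# 3 ⊕ # 7) (# 7) (# 0) ∧ᴰ
        dio-≈ (# 6 ⊗ (con 1 ⊕ # 3)) (# 5) modulus ∧ᴰ dio-< (# 8) modulus ∧ᴰ
        dio-≈ (# 8) (# 2 ⊗ (# 1 ⊗ # 0)) modulus))))))
    (λ ν → mk⇔ (product-sound (ν 0) (ν 1) (ν 2) (ν 3)) (product-complete (ν 0) (ν 1) (ν 2) (ν 3))))
  (t₀ ∷ t₁ ∷ t₂ ∷ t₃ ∷ [])
  where
  modulus = con 1 ⊕ # 6 ⊗ # 4

-- Chinese remaindering

coprime-inverse : ∀ {x m} → Coprime x m → ∃ λ h → x * h ≈ 1 [ m ]
coprime-inverse {x} {m} cop with coprime-Bézout cop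
... | Bézout.+- h y eq = h , mod 0 y (trans (+-identityʳ _) (trans (*-comm x h) (sym eq)))
-- Here x h ≡ -1, so h is corrected by another factor x h, giving (x h)² ≡ 1.
... | Bézout.-+ h y eq = h * (x * h) , ≈-cancelʳ
  (≈-trans (≈-reflexive (factor x h)) (≈-trans (≈-*ʳ (h * x) zero≈) (≈-sym zero≈))) ≈-refl
  where
  zero≈ : 1 + h * x ≈ 0 [ m ]
  zero≈ = ∣⇒≈0 (divides y eq)
  factor : ∀ x h → x * (h * (x * h)) + h * x ≡ (1 + h * x) * (h * x)
  factor = solve-∀

coprime-* : ∀ {a b c} → Coprime a c → Coprime b c → Coprime (a * b) c
coprime-* a⊥c b⊥c (d∣ab , d∣c) = b⊥c (coprime-divisor (λ (i∣d , i∣a) → a⊥c (i∣a , ∣-trans i∣d d∣c)) d∣ab , d∣c)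

coprime-*-∣ : ∀ {a b x} → Coprime a b → a ∣ x → b ∣ x → a * b ∣ x
coprime-*-∣ {a} {b} a⊥b (divides k refl) b∣x = ∣-trans (∣-reflexive (*-comm a b))
  (*-monoˡ-∣ a (coprime-divisor (λ (d∣b , d∣a) → a⊥b (d∣a , d∣b)) (subst (b ∣_) (*-comm k a) b∣x)))

∏-factor : ∀ x d n j → j < n → x + j * d ∣ ∏ x d n
∏-factor x d (suc n) j j<1+n with m≤n⇒m<n∨m≡n (≤-pred j<1+n)
... | inj₁ j<n = ∣m⇒∣m*n (x + n * d) (∏-factor x d n j j<n)
... | inj₂ refl = n∣m*n (∏ x d n)

modulus : ℕ → ℕ → ℕ
modulus t k = 1 + t + k * t

moduli-product : ℕ → ℕ → ℕ
moduli-product t n = ∏ (1 + t) t n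

modulus-coprime : ∀ t k → Coprime (modulus t k) t
modulus-coprime t k {d} (d∣m , d∣t) = ∣1⇒≡1 (∣m+n∣m⇒∣n
  (subst (d ∣_) (+-comm 1 (t + k * t)) d∣m) (∣m∣n⇒∣m+n d∣t (∣n⇒∣m*n k d∣t)))

-- A common divisor divides (j - i) t and is coprime to t, so it divides j - i. Since j - i divides
-- t, the divisor divides t as well and is 1.
moduli-coprime : ∀ t l i j → (∀ k → 0 < k → k < l → k ∣ t) → i < j → j < l → Coprime (modulus t i) (modulus t j)
moduli-coprime t l i j div i<j j<l {d} (d∣i , d∣j) = modulus-coprime t i (d∣i , ∣-trans d∣k (div k 0<k (≤-<-trans (m∸n≤m j i) j<l)))
  where
  k = j ∸ i
  0<k : 0 < k
  0<k = m<n⇒0<n∸m i<j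
  split : modulus t j ≡ modulus t i + k * t
  split = trans (cong (λ j → 1 + t + j * t) (sym (m+[n∸m]≡n (<⇒≤ i<j))))
    (trans (cong (1 + t +_) (*-distribʳ-+ t i k)) (sym (+-assoc (1 + t) (i * t) (k * t))))
  d∣k : d ∣ k
  d∣k = coprime-divisor {n = t} (λ (c∣d , c∣t) → modulus-coprime t i (∣-trans c∣d d∣i , c∣t))
    (subst (d ∣_) (*-comm k t) (∣m+n∣m⇒∣n (subst (d ∣_) split d∣j) d∣i))

module Moduli (t l : ℕ) (div : ∀ k → 0 < k → k < l → k ∣ t) where

  product-coprime : ∀ n k → n ≤ k → k < l → Coprime (moduli-product t n) (modulus t k)
  product-coprime zero k n≤k k<l (d∣1 , _) = ∣1⇒≡1 d∣1
  product-coprime (suc n) k n<k k<l =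
    coprime-* (product-coprime n k (<⇒≤ n<k) k<l) (moduli-coprime t l n k div n<k k<l)

  chinese-remainder : ∀ n → n ≤ l → (z : ℕ → ℕ) → ∃ λ a → ∀ k → k < n → a ≈ z k [ modulus t k ]
  chinese-remainder zero n≤l z = 0 , λ k ()
  chinese-remainder (suc n) n<l z with chinese-remainder n (<⇒≤ n<l) z | coprime-inverse (product-coprime n n ≤-refl n<l)
  ... | a , a≈ | h , h≈ = a + p * h * y , correct
    where
    p = moduli-product t n
    -- t + n t is -1 modulo `modulus t n`, so y stands for z n - a.
    y = z n + a * (t + n * t)
    last : a + p * h * y ≈ z n [ modulus t n ]
    last = ≈-trans (≈-+ (≈-refl {a}) (≈-*ʳ y h≈)) (≈-trans (≈-reflexive (collect a (z n) (t + n * t))) (≈-drop (z n) a))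
      where
      collect : ∀ a z s → a + 1 * (z + a * s) ≡ z + a * (1 + s)
      collect = solve-∀
    correct : ∀ k → k < suc n → a + p * h * y ≈ z k [ modulus t k ]
    correct k k<1+n with m≤n⇒m<n∨m≡n (≤-pred k<1+n)
    ... | inj₂ refl = last
    ... | inj₁ k<n = ≈-trans
      (≈-+ (a≈ k k<n) (∣⇒≈0 (∣m⇒∣m*n y (∣m⇒∣m*n h (∏-factor (1 + t) t n k k<n))))) (≈-reflexive (+-identityʳ (z k)))

  product-∣ : ∀ n → n ≤ l → ∀ x → (∀ k → k < n → modulus t k ∣ x) → moduli-product t n ∣ x
  product-∣ zero n≤l x h = 1∣ x
  product-∣ (suc n) n<l x h =
    coprime-*-∣ (product-coprime n n ≤-refl n<l) (product-∣ n (<⇒≤ n<l) x (λ k k<n → h k (m<n⇒m<1+n k<n))) (h n ≤-refl)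

  product-≈ : ∀ a b → (∀ k → k < l → a ≈ b [ modulus t k ]) → a ≈ b [ moduli-product t l ]
  product-≈ a b h with ≤-total a b
  ... | inj₁ a≤b with m≤n⇒∃[o]m+o≡n a≤b
  ... | d , refl = ≈-sym (≈-trans (≈-+ (≈-refl {a}) (∣⇒≈0 (product-∣ l ≤-refl d λ k k<l → ≈-+⇒∣ (h k k<l)))) (≈-reflexive (+-identityʳ a)))
  product-≈ a b h | inj₂ b≤a with m≤n⇒∃[o]m+o≡n b≤a
  ... | d , refl = ≈-trans (≈-+ (≈-refl {b}) (∣⇒≈0 (product-∣ l ≤-refl d λ k k<l → ≈-+⇒∣ (≈-sym (h k k<l))))) (≈-reflexive (+-identityʳ b))

∣! : ∀ q k → 0 < k → k ≤ q → k ∣ q !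
∣! q (suc k) 0<k k≤q = ∣-trans (m∣m*n (k !)) (m≤n⇒m!∣n! k≤q)

-- Bounded universal quantification

-- A single u serves all witnesses at all k < l, which lets q and the moduli be fixed before the
-- witnesses are packed.
Bounded⟦_⟧ : DioForm → ℕ → Val → Set
Bounded⟦ i ≐ᶜ n ⟧ u ν = ν i ≡ n
Bounded⟦ i ≐ᵛ j ⟧ u ν = ν i ≡ ν j
Bounded⟦ ≐add i j k ⟧ u ν = ν i ≡ ν j + ν k
Bounded⟦ ≐mul i j k ⟧ u ν = ν i ≡ ν j * ν k
Bounded⟦ A ∧̇ B ⟧ u ν = Bounded⟦ A ⟧ u ν × Bounded⟦ B ⟧ u ν
Bounded⟦ A ∨̇ B ⟧ u ν = Bounded⟦ A ⟧ u ν ⊎ Bounded⟦ B ⟧ u ν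
Bounded⟦ ∃̇ A ⟧ u ν = Σ ℕ λ n → n ≤ u × Bounded⟦ A ⟧ u (n · ν)

bounded-mono : ∀ A {u v ν} → u ≤ v → Bounded⟦ A ⟧ u ν → Bounded⟦ A ⟧ v ν
bounded-mono (i ≐ᶜ n) u≤v p = p
bounded-mono (i ≐ᵛ j) u≤v p = p
bounded-mono (≐add i j k) u≤v p = p
bounded-mono (≐mul i j k) u≤v p = p
bounded-mono (A ∧̇ B) u≤v (a , b) = bounded-mono A u≤v a , bounded-mono B u≤v b
bounded-mono (A ∨̇ B) u≤v (inj₁ a) = inj₁ (bounded-mono A u≤v a)
bounded-mono (A ∨̇ B) u≤v (inj₂ b) = inj₂ (bounded-mono B u≤v b)
bounded-mono (∃̇ A) u≤v (n , n≤u , a) = n , ≤-trans n≤u u≤v , bounded-mono A u≤v a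

bounded-exists : ∀ A {ν} → ⟦ A ⟧ ν → ∃ λ u → Bounded⟦ A ⟧ u ν
bounded-exists (i ≐ᶜ n) p = 0 , p
bounded-exists (i ≐ᵛ j) p = 0 , p
bounded-exists (≐add i j k) p = 0 , p
bounded-exists (≐mul i j k) p = 0 , p
bounded-exists (A ∧̇ B) (a , b) with bounded-exists A a | bounded-exists B b
... | u , a′ | v , b′ = u + v , bounded-mono A (m≤m+n u v) a′ , bounded-mono B (m≤n+m v u) b′
bounded-exists (A ∨̇ B) (inj₁ a) = let u , a′ = bounded-exists A a in u , inj₁ a′
bounded-exists (A ∨̇ B) (inj₂ b) = let u , b′ = bounded-exists B b in u , inj₂ b′
bounded-exists (∃̇ A) (n , a) with bounded-exists A a
... | u , a′ = n + u , n , m≤m+n n u , bounded-mono A (m≤n+m u n) a′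

bounded-uniform : ∀ A l (Z : ℕ → Val) → (∀ k → k < l → ⟦ A ⟧ (Z k)) → ∃ λ u → ∀ k → k < l → Bounded⟦ A ⟧ u (Z k)
bounded-uniform A zero Z h = 0 , λ k ()
bounded-uniform A (suc l) Z h
  with bounded-uniform A l Z (λ k k<l → h k (m<n⇒m<1+n k<l)) | bounded-exists A (h l ≤-refl)
... | u , p | v , q = u + v , uniform
  where
  uniform : ∀ k → k < suc l → Bounded⟦ A ⟧ (u + v) (Z k)
  uniform k k<1+l with m≤n⇒m<n∨m≡n (≤-pred k<1+l)
  ... | inj₁ k<l = bounded-mono A (m≤m+n u v) (p k k<l)
  ... | inj₂ refl = bounded-mono A (m≤n+m v u) q

-- The terms of the formula are monotone, so it suffices to bound them at an upper bound β
-- of the valuation, with u in place of each quantified variable.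
AtomBound : DioForm → ℕ → ℕ → Val → Set
AtomBound (i ≐ᶜ n) u q β = β i + n ≤ q
AtomBound (i ≐ᵛ j) u q β = β i + β j ≤ q
AtomBound (≐add i j k) u q β = β i + (β j + β k) ≤ q
AtomBound (≐mul i j k) u q β = β i + β j * β k ≤ q
AtomBound (A ∧̇ B) u q β = AtomBound A u q β × AtomBound B u q β
AtomBound (A ∨̇ B) u q β = AtomBound A u q β × AtomBound B u q β
AtomBound (∃̇ A) u q β = AtomBound A u q (u · β)

atom-bound-mono : ∀ A {u q r β} → q ≤ r → AtomBound A u q β → AtomBound A u r β
atom-bound-mono (i ≐ᶜ n) q≤r p = ≤-trans p q≤r
atom-bound-mono (i ≐ᵛ j) q≤r p = ≤-trans p q≤r
atom-bound-mono (≐add i j k) q≤r p = ≤-trans p q≤r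
atom-bound-mono (≐mul i j k) q≤r p = ≤-trans p q≤r
atom-bound-mono (A ∧̇ B) q≤r (a , b) = atom-bound-mono A q≤r a , atom-bound-mono B q≤r b
atom-bound-mono (A ∨̇ B) q≤r (a , b) = atom-bound-mono A q≤r a , atom-bound-mono B q≤r b
atom-bound-mono (∃̇ A) q≤r a = atom-bound-mono A q≤r a

atom-bound-exists : ∀ A u β → ∃ λ q → AtomBound A u q β
atom-bound-exists (i ≐ᶜ n) u β = _ , ≤-refl
atom-bound-exists (i ≐ᵛ j) u β = _ , ≤-refl
atom-bound-exists (≐add i j k) u β = _ , ≤-refl
atom-bound-exists (≐mul i j k) u β = _ , ≤-refl
atom-bound-exists (A ∧̇ B) u β with atom-bound-exists A u β | atom-bound-exists B u β
... | q , a | r , b = q + r , atom-bound-mono A (m≤m+n q r) a , atom-bound-mono B (m≤n+m r q) b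
atom-bound-exists (A ∨̇ B) u β with atom-bound-exists A u β | atom-bound-exists B u β
... | q , a | r , b = q + r , atom-bound-mono A (m≤m+n q r) a , atom-bound-mono B (m≤n+m r q) b
atom-bound-exists (∃̇ A) u β = atom-bound-exists A u (u · β)

-- Modulo a prime factor of N that does not divide the guard e, this is the truth of
-- the formula at α; e ≡ 0 makes it void, which is how a disjunct is discarded.
-- Each witness a is forced below u modulo every prime factor by dividing
-- ∏ (j − a) over j ≤ u, where b stands for −a.
Encoding : DioForm → ℕ → ℕ → ℕ → Val → Set
Encoding (i ≐ᶜ n) N u e α = e * α i ≈ e * n [ N ]
Encoding (i ≐ᵛ j) N u e α = e * α i ≈ e * α j [ N ]
Encoding (≐add i j k) N u e α = e * α i ≈ e * (α j + α k) [ N ]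
Encoding (≐mul i j k) N u e α = e * α i ≈ e * (α j * α k) [ N ]
Encoding (A ∧̇ B) N u e α = Encoding A N u e α × Encoding B N u e α
Encoding (A ∨̇ B) N u e α = Σ ℕ λ d → Σ ℕ λ d′ → Σ ℕ λ f → Σ ℕ λ f′ →
  d + d′ ≈ 1 [ N ] × f ≡ e * d × f′ ≡ e * d′ × Encoding A N u f α × Encoding B N u f′ α
Encoding (∃̇ A) N u e α = Σ ℕ λ a → Σ ℕ λ b → Σ ℕ λ y →
  N ∣ a + b × (0 < 1 × y ≡ ∏ b 1 (suc u)) × N ∣ y × Encoding A N u e (a · α)

dio-encoding : ∀ A → Dio (λ ν → Encoding A (ν 0) (ν 1) (ν 2) (λ i → ν (3 + i)))
dio-encoding (i ≐ᶜ n) = dio-≈ (# 2 ⊗ # (3 + i)) (# 2 ⊗ con n) (# 0)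
dio-encoding (i ≐ᵛ j) = dio-≈ (# 2 ⊗ # (3 + i)) (# 2 ⊗ # (3 + j)) (# 0)
dio-encoding (≐add i j k) = dio-≈ (# 2 ⊗ # (3 + i)) (# 2 ⊗ (# (3 + j) ⊕ # (3 + k))) (# 0)
dio-encoding (≐mul i j k) = dio-≈ (# 2 ⊗ # (3 + i)) (# 2 ⊗ (# (3 + j) ⊗ # (3 + k))) (# 0)
dio-encoding (A ∧̇ B) = dio-encoding A ∧ᴰ dio-encoding B
dio-encoding (A ∨̇ B) = dio-∃ (dio-∃ (dio-∃ (dio-∃
  (dio-≈ (# 3 ⊕ # 2) (con 1) (# 4) ∧ᴰ dio-≡ (# 1) (# 6 ⊗ # 3) ∧ᴰ dio-≡ (# 0) (# 6 ⊗ # 2) ∧ᴰ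
   guarded A 1 ∧ᴰ guarded B 0))))
  where
  guarded : ∀ A f → Dio (λ ν → Encoding A (ν 4) (ν 5) (ν f) (λ i → ν (7 + i)))
  guarded A f = dio-at (dio-encoding A)
    (λ ν → ν 4 · (ν 5 · (ν f · λ i → ν (7 + i))))
    (λ { 0 → # 4 ; 1 → # 5 ; 2 → # f ; (suc (suc (suc i))) → # (7 + i) })
    (λ { ν 0 → refl ; ν 1 → refl ; ν 2 → refl ; ν (suc (suc (suc i))) → refl })
dio-encoding (∃̇ A) = dio-∃ (dio-∃ (dio-∃
  (dio-∣ (# 3) (# 2 ⊕ # 1) ∧ᴰ dio-∏ (# 1) (con 1) (con 1 ⊕ # 4) (# 0) ∧ᴰ dio-∣ (# 3) (# 0) ∧ᴰ
   dio-at (dio-encoding A)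
     (λ ν → ν 3 · (ν 4 · (ν 5 · (ν 2 · λ i → ν (6 + i)))))
     (λ { 0 → # 3 ; 1 → # 4 ; 2 → # 5 ; 3 → # 2 ; (suc (suc (suc (suc i)))) → # (6 + i) })
     (λ { ν 0 → refl ; ν 1 → refl ; ν 2 → refl ; ν 3 → refl ; ν (suc (suc (suc (suc i)))) → refl }))))

dio-atom-bound : ∀ A → Dio (λ ν → AtomBound A (ν 0) (ν 1) (λ i → ν (2 + i)))
dio-atom-bound (i ≐ᶜ n) = dio-≤ (# (2 + i) ⊕ con n) (# 1)
dio-atom-bound (i ≐ᵛ j) = dio-≤ (# (2 + i) ⊕ # (2 + j)) (# 1)
dio-atom-bound (≐add i j k) = dio-≤ (# (2 + i) ⊕ (# (2 + j) ⊕ # (2 + k))) (# 1)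
dio-atom-bound (≐mul i j k) = dio-≤ (# (2 + i) ⊕ (# (2 + j) ⊗ # (2 + k))) (# 1)
dio-atom-bound (A ∧̇ B) = dio-atom-bound A ∧ᴰ dio-atom-bound B
dio-atom-bound (A ∨̇ B) = dio-atom-bound A ∧ᴰ dio-atom-bound B
dio-atom-bound (∃̇ A) = dio-at (dio-atom-bound A)
  (λ ν → ν 0 · (ν 1 · (ν 0 · λ i → ν (2 + i))))
  (λ { 0 → # 0 ; 1 → # 1 ; 2 → # 0 ; (suc (suc (suc i))) → # (2 + i) })
  (λ { ν 0 → refl ; ν 1 → refl ; ν 2 → refl ; ν (suc (suc (suc i))) → refl })

-- Soundness of the encoding modulo one prime factor

module PrimeFactor (p N u q : ℕ) (pp : Prime p) (p∣N : p ∣ N) (q<p : q < p) where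

  cancel-∣ : ∀ {e d} → ¬ p ∣ e → p ∣ e * d → p ∣ d
  cancel-∣ {e} {d} p∤e h = [ (λ p∣e → contradiction p∣e p∤e) , id ]′ (euclidsLemma e d pp h)

  cancel-≈ : ∀ e x y → ¬ p ∣ e → e * x ≈ e * y [ p ] → x ≈ y [ p ]
  cancel-≈ e x y p∤e h =
    [ (λ x≤y → ≈-sym (ascending x≤y h)) , (λ y≤x → ascending y≤x (≈-sym h)) ]′ (≤-total x y)
    where
    ascending : ∀ {x y} → x ≤ y → e * x ≈ e * y [ p ] → y ≈ x [ p ]
    ascending {x} {y} x≤y h = ≈-trans (≈-reflexive (sym (m+[n∸m]≡n x≤y)))
      (≈-trans (≈-+ (≈-refl {x}) (∣⇒≈0 (cancel-∣ p∤e p∣ed))) (≈-reflexive (+-identityʳ x)))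
      where
      p∣ed : p ∣ e * (y ∸ x)
      p∣ed = ≈-+⇒∣ (≈-trans h (≈-reflexive (trans (cong (e *_) (sym (m+[n∸m]≡n x≤y))) (*-distribˡ-+ e x (y ∸ x)))))

  -- The guard cancels modulo p, and the true values of both sides are at most q < p, so their
  -- congruence is an equality.
  atom-sound : ∀ {e x y x′ y′ b} → ¬ p ∣ e → e * x′ ≈ e * y′ [ N ] → x ≈ x′ [ p ] → y ≈ y′ [ p ] →
               x + y ≤ b → b ≤ q → x ≡ y
  atom-sound {e} {x} {y} {x′} {y′} p∤e h x≈ y≈ x+y≤b b≤q = ≈-unique
    (≈-trans x≈ (≈-trans (cancel-≈ e x′ y′ p∤e (≈-coarsen p∣N h)) (≈-sym y≈)))
    (≤-<-trans (≤-trans (m≤m+n x y) (≤-trans x+y≤b b≤q)) q<p) (≤-<-trans (≤-trans (m≤n+m y x) (≤-trans x+y≤b b≤q)) q<p)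

  p≢1 : p ≢ 1
  p≢1 refl = contradiction pp λ ()

  ∏-∣⇒factor : ∀ b n → p ∣ ∏ b 1 n → ∃ λ j → j < n × p ∣ b + j
  ∏-∣⇒factor b zero p∣1 = contradiction (∣1⇒≡1 p∣1) p≢1
  ∏-∣⇒factor b (suc n) p∣ =
    [ (λ h → let j , j<n , p∣b+j = ∏-∣⇒factor b n h in j , m<n⇒m<1+n j<n , p∣b+j)
    , (λ h → n , ≤-refl , subst (λ n → p ∣ b + n) (*-identityʳ n) h)
    ]′ (euclidsLemma (∏ b 1 n) (b + n * 1) pp p∣)

  encoding-sound : ∀ A {e α β ν} → ¬ p ∣ e → (∀ i → ν i ≈ α i [ p ]) → (∀ i → ν i ≤ β i) →
                   AtomBound A u q β → Encoding A N u e α → ⟦ A ⟧ ν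
  encoding-sound (i ≐ᶜ n) p∤e ν≈ ν≤ bd h =
    atom-sound p∤e h (ν≈ i) ≈-refl (+-monoˡ-≤ n (ν≤ i)) bd
  encoding-sound (i ≐ᵛ j) p∤e ν≈ ν≤ bd h =
    atom-sound p∤e h (ν≈ i) (ν≈ j) (+-mono-≤ (ν≤ i) (ν≤ j)) bd
  encoding-sound (≐add i j k) p∤e ν≈ ν≤ bd h =
    atom-sound p∤e h (ν≈ i) (≈-+ (ν≈ j) (ν≈ k)) (+-mono-≤ (ν≤ i) (+-mono-≤ (ν≤ j) (ν≤ k))) bd
  encoding-sound (≐mul i j k) p∤e ν≈ ν≤ bd h =
    atom-sound p∤e h (ν≈ i) (≈-* (ν≈ j) (ν≈ k)) (+-mono-≤ (ν≤ i) (*-mono-≤ (ν≤ j) (ν≤ k))) bd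
  encoding-sound (A ∧̇ B) p∤e ν≈ ν≤ (bdA , bdB) (a , b) =
    encoding-sound A p∤e ν≈ ν≤ bdA a , encoding-sound B p∤e ν≈ ν≤ bdB b
  encoding-sound (A ∨̇ B) {e} p∤e ν≈ ν≤ (bdA , bdB) (d , d′ , _ , _ , d+d′≈1 , refl , refl , a , b) with p ∣? d
  -- As d + d′ ≡ 1, p does not divide both, so one of the two guards stays invertible.
  ... | no p∤d = inj₁ (encoding-sound A (λ h → p∤d (cancel-∣ p∤e h)) ν≈ ν≤ bdA a)
  ... | yes p∣d = inj₂ (encoding-sound B
    (λ h → p≢1 (∣1⇒≡1 (≈-∣ (≈-coarsen p∣N d+d′≈1) (∣m∣n⇒∣m+n p∣d (cancel-∣ p∤e h))))) ν≈ ν≤ bdB b)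
  encoding-sound (∃̇ A) {α = α} {β} {ν} p∤e ν≈ ν≤ bd (a , b , _ , N∣a+b , (_ , refl) , N∣∏ , h) =
    -- p divides some factor b + j ≡ j - a with j ≤ u, so j is the actual witness packed in a at
    -- this prime.
    let j , j<1+u , p∣b+j = ∏-∣⇒factor b (suc u) (∣-trans p∣N N∣∏)
    in j , encoding-sound A p∤e (extend-≈ p∣b+j) (λ { zero → ≤-pred j<1+u ; (suc i) → ν≤ i }) bd h
    where
    extend-≈ : ∀ {j} → p ∣ b + j → ∀ i → (j · ν) i ≈ (a · α) i [ p ]
    extend-≈ p∣b+j zero = ≈-cancelˡ (≈-trans (∣⇒≈0 p∣b+j)
      (≈-sym (≈-trans (≈-reflexive (+-comm b a)) (∣⇒≈0 (∣-trans p∣N N∣a+b))))) (≈-refl {b})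
    extend-≈ p∣b+j (suc i) = ν≈ i

-- Extends choices made below l by 0, since `chinese-remainder` packs total functions.
choose : ∀ {l} {P : ℕ → ℕ → Set} → (∀ k → k < l → Σ ℕ (P k)) → Σ (ℕ → ℕ) λ z → ∀ k → k < l → P k (z k)
choose {l} {P} h = z , correct
  where
  z : ℕ → ℕ
  z k with k <? l
  ... | yes k<l = proj₁ (h k k<l)
  ... | no _ = 0
  correct : ∀ k → k < l → P k (z k)
  correct k k<l with k <? l
  ... | yes k<l′ = proj₂ (h k k<l′)
  ... | no k≮l = contradiction k<l k≮l

-- Completeness of the encoding by Chinese remaindering

module Completeness (t l u : ℕ) (div : ∀ k → 0 < k → k < l → k ∣ t) where
  open Moduli t l div

  N : ℕ
  N = moduli-product t l

  modulus∣N : ∀ k → k < l → modulus t k ∣ N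
  modulus∣N = ∏-factor (1 + t) t l

  0<N : 0 < N
  0<N = positive l
    where
    positive : ∀ n → 0 < moduli-product t n
    positive zero = s≤s z≤n
    positive (suc n) = *-mono-≤ {1} {_} {1} (positive n) (s≤s z≤n)

  atom-complete : ∀ {e x y} {X Y : ℕ → ℕ} → (∀ k → k < l → x ≈ X k [ modulus t k ]) → (∀ k → k < l → y ≈ Y k [ modulus t k ]) →
                  (∀ k → k < l → modulus t k ∣ e ⊎ X k ≡ Y k) → e * x ≈ e * y [ N ]
  atom-complete {e} {x} {y} x≈ y≈ h = product-≈ (e * x) (e * y) pointwise
    where
    pointwise : ∀ k → k < l → e * x ≈ e * y [ modulus t k ]
    pointwise k k<l with h k k<l
    ... | inj₁ m∣e = ≈-trans (∣⇒≈0 (∣m⇒∣m*n x m∣e)) (≈-sym (∣⇒≈0 (∣m⇒∣m*n y m∣e)))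
    ... | inj₂ X≡Y = ≈-*ˡ e (≈-trans (x≈ k k<l) (≈-trans (≈-reflexive X≡Y) (≈-sym (y≈ k k<l))))

  -- The alternative that the modulus divides the guard keeps the induction going for a disjunct
  -- that was not chosen at k.
  encoding-complete : ∀ A {e α} (Z : ℕ → Val) → (∀ k → k < l → ∀ i → α i ≈ Z k i [ modulus t k ]) →
                      (∀ k → k < l → modulus t k ∣ e ⊎ Bounded⟦ A ⟧ u (Z k)) → Encoding A N u e α
  encoding-complete (i ≐ᶜ n) Z α≈ h = atom-complete (λ k k<l → α≈ k k<l i) (λ k k<l → ≈-refl) h
  encoding-complete (i ≐ᵛ j) Z α≈ h = atom-complete (λ k k<l → α≈ k k<l i) (λ k k<l → α≈ k k<l j) h
  encoding-complete (≐add i j m) Z α≈ h =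
    atom-complete (λ k k<l → α≈ k k<l i) (λ k k<l → ≈-+ (α≈ k k<l j) (α≈ k k<l m)) h
  encoding-complete (≐mul i j m) Z α≈ h =
    atom-complete (λ k k<l → α≈ k k<l i) (λ k k<l → ≈-* (α≈ k k<l j) (α≈ k k<l m)) h
  encoding-complete (A ∧̇ B) Z α≈ h =
    encoding-complete A Z α≈ (λ k k<l → map₂ proj₁ (h k k<l)) , encoding-complete B Z α≈ (λ k k<l → map₂ proj₂ (h k k<l))
  encoding-complete (A ∨̇ B) {e} {α} Z α≈ h =
    let z , z✓ = choose {P = Choice} decide
        d , d≈ = chinese-remainder l ≤-refl z
        d′ , d′≈ = chinese-remainder l ≤-refl (λ k → 1 ∸ z k)
    in d , d′ , e * d , e * d′ ,
       product-≈ (d + d′) 1 (λ k k<l → ≈-trans (≈-+ (d≈ k k<l) (d′≈ k k<l)) (≈-reflexive (complement (z✓ k k<l)))) ,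
       refl , refl ,
       encoding-complete A Z α≈ (λ k k<l → left d (d≈ k k<l) (z✓ k k<l)) ,
       encoding-complete B Z α≈ (λ k k<l → right d′ (d′≈ k k<l) (z✓ k k<l))
    where
    Choice : ℕ → ℕ → Set
    Choice k c = c ≡ 1 × (modulus t k ∣ e ⊎ Bounded⟦ A ⟧ u (Z k)) ⊎ c ≡ 0 × (modulus t k ∣ e ⊎ Bounded⟦ B ⟧ u (Z k))
    decide : ∀ k → k < l → Σ ℕ (Choice k)
    decide k k<l with h k k<l
    ... | inj₁ m∣e = 1 , inj₁ (refl , inj₁ m∣e)
    ... | inj₂ (inj₁ a) = 1 , inj₁ (refl , inj₂ a)
    ... | inj₂ (inj₂ b) = 0 , inj₂ (refl , inj₂ b)
    complement : ∀ {k c} → Choice k c → c + (1 ∸ c) ≡ 1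
    complement (inj₁ (refl , _)) = refl
    complement (inj₂ (refl , _)) = refl
    left : ∀ {k c} d → d ≈ c [ modulus t k ] → Choice k c → modulus t k ∣ e * d ⊎ Bounded⟦ A ⟧ u (Z k)
    left d d≈ (inj₁ (refl , p)) = map₁ (∣m⇒∣m*n d) p
    left d d≈ (inj₂ (refl , _)) = inj₁ (∣n⇒∣m*n e (≈0⇒∣ d≈))
    right : ∀ {k c} d → d ≈ 1 ∸ c [ modulus t k ] → Choice k c → modulus t k ∣ e * d ⊎ Bounded⟦ B ⟧ u (Z k)
    right d d≈ (inj₁ (refl , _)) = inj₁ (∣n⇒∣m*n e (≈0⇒∣ d≈))
    right d d≈ (inj₂ (refl , p)) = map₁ (∣m⇒∣m*n d) p
  encoding-complete (∃̇ A) {e} {α} Z α≈ h =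
    let z , z✓ = choose {P = λ k c → c ≤ u × (modulus t k ∣ e ⊎ Bounded⟦ A ⟧ u (c · Z k))} decide
        a , a≈ = chinese-remainder l ≤-refl z
        b = a * (N ∸ 1)
        N∣a+b : N ∣ a + b
        N∣a+b = divides a (trans (sym (*-suc a (N ∸ 1))) (cong (a *_) (m+[n∸m]≡n 0<N)))
    in a , b , _ , N∣a+b , (s≤s z≤n , refl) ,
       product-∣ l ≤-refl _ (λ k k<l → ∣-trans (factor b (z k) (N∣a+b) k k<l (a≈ k k<l)) (∏-factor b 1 (suc u) (z k) (s≤s (proj₁ (z✓ k k<l))))) ,
       encoding-complete A (λ k → z k · Z k) (λ { k k<l zero → a≈ k k<l ; k k<l (suc i) → α≈ k k<l i }) (λ k k<l → proj₂ (z✓ k k<l))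
    where
    decide : ∀ k → k < l → Σ ℕ λ c → c ≤ u × (modulus t k ∣ e ⊎ Bounded⟦ A ⟧ u (c · Z k))
    decide k k<l with h k k<l
    -- The product must vanish modulo this modulus even though the guard does, so a default witness
    -- within the bound u is supplied.
    ... | inj₁ m∣e = 0 , z≤n , inj₁ m∣e
    ... | inj₂ (c , c≤u , p) = c , c≤u , inj₂ p
    factor : ∀ {a} b c → N ∣ a + b → ∀ k → k < l → a ≈ c [ modulus t k ] → modulus t k ∣ b + c * 1
    factor {a} b c N∣a+b k k<l a≈ = ≈-∣
      (≈-trans (≈-+ a≈ (≈-refl {b})) (≈-reflexive (trans (+-comm c b) (cong (b +_) (sym (*-identityʳ c))))))
      (∣-trans (modulus∣N k k<l) N∣a+b)

-- Elimination of the bounded quantifier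

prime-factor : ∀ n → 1 < n → ∃ λ p → Prime p × p ∣ n
prime-factor n 1<n = head-factor (factors f) (isFactorisation f) (factorsPrime f)
  where
  open PrimeFactorisation
  f = factorise n {{>-nonZero (<-trans (s≤s z≤n) 1<n)}}
  head-factor : ∀ ps → n ≡ product ps → All Prime ps → ∃ λ p → Prime p × p ∣ n
  head-factor [] n≡1 _ = contradiction (sym n≡1) (<⇒≢ 1<n)
  head-factor (p ∷ ps) n≡ (pp ∷ _) = p , pp , subst (p ∣_) (sym n≡) (m∣m*n (product ps))

-- c packs the bound variable itself: t is invertible modulo each prime factor of `modulus t k`, so
-- `N ∣ 1 + t + c * t` forces c ≡ k there. The initial guard e = 1 is a variable, as `dio-encoding`
-- expects.
UniversalSystem : DioForm → ℕ → Val → Set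
UniversalSystem A l ν = Σ ℕ λ u → Σ ℕ λ q → Σ ℕ λ t → Σ ℕ λ N → Σ ℕ λ c → Σ ℕ λ e →
  AtomBound A u q (l · ν) × t ≡ q ! × (0 < t × N ≡ ∏ (1 + t) t l) × N ∣ 1 + t + c * t × e ≡ 1 ×
  Encoding A N u e (c · ν)

dio-universal : ∀ A i → Dio (λ ν → UniversalSystem A (ν i) ν)
dio-universal A i = dio-∃ (dio-∃ (dio-∃ (dio-∃ (dio-∃ (dio-∃
  (dio-at (dio-atom-bound A)
     (λ ν → ν 5 · (ν 4 · (ν (6 + i) · λ j → ν (6 + j))))
     (λ { 0 → # 5 ; 1 → # 4 ; 2 → # (6 + i) ; (suc (suc (suc j))) → # (6 + j) })
     (λ { ν 0 → refl ; ν 1 → refl ; ν 2 → refl ; ν (suc (suc (suc j))) → refl }) ∧ᴰ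
   dio-! (# 4) (# 3) ∧ᴰ dio-∏ (con 1 ⊕ # 3) (# 3) (# (6 + i)) (# 2) ∧ᴰ dio-∣ (# 2) (con 1 ⊕ # 3 ⊕ # 1 ⊗ # 3) ∧ᴰ
   dio-≡ (# 0) (con 1) ∧ᴰ
   dio-at (dio-encoding A)
     (λ ν → ν 2 · (ν 5 · (ν 0 · (ν 1 · λ j → ν (6 + j)))))
     (λ { 0 → # 2 ; 1 → # 5 ; 2 → # 0 ; 3 → # 1 ; (suc (suc (suc (suc j)))) → # (6 + j) })
     (λ { ν 0 → refl ; ν 1 → refl ; ν 2 → refl ; ν 3 → refl ; ν (suc (suc (suc (suc j)))) → refl })))))))

universal-sound : ∀ A l ν → UniversalSystem A l ν → ∀ k → k < l → ⟦ A ⟧ (k · ν)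
universal-sound A l ν (u , q , t , N , c , _ , bd , t≡q! , (0<t , refl) , N∣ , refl , enc) k k<l =
  let p , pp , p∣m = prime-factor (modulus t k) (s≤s (≤-trans 0<t (m≤m+n t (k * t))))
  in at-prime p pp p∣m
  where
  at-prime : ∀ p → Prime p → p ∣ modulus t k → ⟦ A ⟧ (k · ν)
  at-prime p pp p∣m = encoding-sound A (λ p∣1 → p≢1 (∣1⇒≡1 p∣1)) k≈ k≤ bd enc
    where
    p∣N : p ∣ moduli-product t l
    p∣N = ∣-trans p∣m (∏-factor (1 + t) t l k k<l)
    p∤t : ¬ p ∣ t
    p∤t p∣t with modulus-coprime t k (p∣m , p∣t)
    ... | refl = contradiction pp λ ()
    q<p : q < p
    q<p = ≰⇒> λ p≤q → p∤t (subst (p ∣_) (sym t≡q!) (∣! q p (>-nonZero⁻¹ p {{prime⇒nonZero pp}}) p≤q))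
    open PrimeFactor p (moduli-product t l) u q pp p∣N q<p
    k≈c : k ≈ c [ p ]
    k≈c = cancel-≈ t k c p∤t (subst₂ _≈_[ p ] (*-comm k t) (*-comm c t)
      (≈-cancelˡ (≈-trans (∣⇒≈0 p∣m) (≈-sym (∣⇒≈0 (∣-trans p∣N N∣)))) (≈-refl {1 + t})))
    k≈ : ∀ i → (k · ν) i ≈ (c · ν) i [ p ]
    k≈ zero = k≈c
    k≈ (suc i) = ≈-refl
    k≤ : ∀ i → (k · ν) i ≤ (l · ν) i
    k≤ zero = <⇒≤ k<l
    k≤ (suc i) = ≤-refl

universal-complete : ∀ A l ν → (∀ k → k < l → ⟦ A ⟧ (k · ν)) → UniversalSystem A l ν
universal-complete A l ν h =
  let u , bounded = bounded-uniform A l (_· ν) h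
      r , bd = atom-bound-exists A u (l · ν)
  in build u bounded r bd
  where
  build : ∀ u → (∀ k → k < l → Bounded⟦ A ⟧ u (k · ν)) → ∀ r → AtomBound A u r (l · ν) → UniversalSystem A l ν
  build u bounded r bd =
    let c , c≈ = chinese-remainder l ≤-refl id
    in u , q , t , N , c , 1 , atom-bound-mono A (m≤m+n r l) bd , refl , (1≤n! q , refl) ,
       product-∣ l ≤-refl _ (λ k k<l → ≈-∣ (≈-+ (≈-refl {1 + t}) (≈-*ʳ t (≈-sym (c≈ k k<l)))) ∣-refl) , refl ,
       encoding-complete A (_· ν) (λ { k k<l zero → c≈ k k<l ; k k<l (suc i) → ≈-refl }) (λ k k<l → inj₂ (bounded k k<l))
    where
    -- r bounds the atoms; l makes every k < l divide q!, so that the moduli are pairwise coprime.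
    q = r + l
    t = q !
    div : ∀ k → 0 < k → k < l → k ∣ t
    div k 0<k k<l = ∣! q k 0<k (≤-trans (<⇒≤ k<l) (m≤n+m l r))
    open Moduli t l div
    open Completeness t l u div

dio-∀< : {S : ℕ → Val → Set} → Dio (λ ν → S (ν 0) (↑ ν)) → ∀ i → Dio (λ ν → ∀ k → k < ν i → S k ν)
dio-∀< (A , w) i = dio-⇔ (λ ν → UniversalSystem A (ν i) ν) (dio-universal A i) λ ν → mk⇔
  (λ s k k<l → to (w (k · ν)) (universal-sound A (ν i) ν s k k<l))
  (λ h → universal-complete A (ν i) ν (λ k k<l → from (w (k · ν)) (h k k<l)))

-- Reflexive-transitive closure

-- Gödel's β function: c is the k-th entry of the sequence coded by g and t.
Entry : ℕ → ℕ → ℕ → ℕ → Set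
Entry g t k c = g ≈ c [ 1 + t + k * t ] × c ≤ t

entry-unique : ∀ {g t k c d} → Entry g t k c → Entry g t k d → c ≡ d
entry-unique {t = t} {k} (g≈c , c≤t) (g≈d , d≤t) =
  ≈-unique (≈-trans (≈-sym g≈c) g≈d) (s≤s (≤-trans c≤t (m≤m+n t (k * t)))) (s≤s (≤-trans d≤t (m≤m+n t (k * t))))

module _ (R : ℕ → ℕ → Set) where

  Path : ℕ → ℕ → ℕ → ℕ → ℕ → Set
  Path x y l g t = Entry g t 0 x × Entry g t l y ×
    (∀ k → k < l → Σ ℕ λ c → Σ ℕ λ d → Entry g t k c × Entry g t (suc k) d × R c d)

  -- Steps are removed at the far end, so that the shorter path keeps the same code and start.
  path-sound : ∀ {x y g t} l → Path x y l g t → Star R x y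
  path-sound zero (x✓ , y✓ , _) with entry-unique {k = 0} x✓ y✓
  ... | refl = ε
  path-sound (suc l) (x✓ , y✓ , step) with step l ≤-refl
  ... | c , d , c✓ , d✓ , r with entry-unique {k = suc l} d✓ y✓
  ... | refl = path-sound l (x✓ , c✓ , λ k k<l → step k (m<n⇒m<1+n k<l)) ◅◅ (r ◅ ε)

  sequence : ∀ {x y} → Star R x y → ∃ λ l → Σ (ℕ → ℕ) λ z → z 0 ≡ x × z l ≡ y × (∀ k → k < l → R (z k) (z (suc k)))
  sequence {x} ε = 0 , (λ _ → x) , refl , refl , λ k ()
  sequence {x} (r ◅ rs) with sequence rs
  ... | l , z , refl , refl , step = suc l , x · z , refl , refl , λ { zero _ → r ; (suc k) k<l → step k (≤-pred k<l) }

  path-complete : ∀ {x y} → Star R x y → ∃ λ l → ∃ λ g → ∃ λ t → Path x y l g t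
  path-complete rs with sequence rs
  ... | l , z , refl , refl , step =
    let g , g≈ = chinese-remainder (suc l) ≤-refl z
        entry : ∀ k → k ≤ l → Entry g t k (z k)
        entry k k≤l = g≈ k (s≤s k≤l) , z≤t k k≤l
    in l , g , t , entry 0 z≤n , entry l ≤-refl ,
       λ k k<l → z k , z (suc k) , entry k (<⇒≤ k<l) , entry (suc k) k<l , step k k<l
    where
    total : ℕ → ℕ
    total zero = z 0
    total (suc k) = total k + z (suc k)
    z≤total : ∀ k n → k ≤ n → z k ≤ total n
    z≤total zero zero _ = ≤-refl
    z≤total k (suc n) k≤1+n with m≤n⇒m<n∨m≡n k≤1+n
    ... | inj₁ k<1+n = ≤-trans (z≤total k n (≤-pred k<1+n)) (m≤m+n _ _)
    ... | inj₂ refl = m≤n+m _ (total n)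
    -- `total l` bounds the entries, as required by c ≤ t; l makes the moduli coprime.
    q = total l + l
    t = q !
    n≤n! : ∀ n → n ≤ n !
    n≤n! zero = z≤n
    n≤n! (suc n) = ≤-trans (≤-reflexive (sym (*-identityʳ (suc n)))) (*-monoʳ-≤ (suc n) (1≤n! n))
    z≤t : ∀ k → k ≤ l → z k ≤ t
    z≤t k k≤l = ≤-trans (z≤total k l k≤l) (≤-trans (m≤m+n _ l) (n≤n! q))
    div : ∀ k → 0 < k → k < suc l → k ∣ t
    div k 0<k k<1+l = ∣! q k 0<k (≤-trans (≤-pred k<1+l) (m≤n+m l (total l)))
    open Moduli t (suc l) div

  dio-entry : ∀ g t k c → Dio (λ ν → Entry (eval g ν) (eval t ν) (eval k ν) (eval c ν))
  dio-entry g t k c = dio-≈ g c (con 1 ⊕ t ⊕ k ⊗ t) ∧ᴰ dio-≤ c t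

  dio-Star : Dio (λ ν → R (ν 1) (ν 0)) → Dio (λ ν → Star R (ν 1) (ν 0))
  dio-Star D = dio-⇔ (λ ν → Σ ℕ λ l → Σ ℕ λ g → Σ ℕ λ t → Path (ν 1) (ν 0) l g t)
    (dio-∃ (dio-∃ (dio-∃
      (dio-entry (# 1) (# 0) (con 0) (# 4) ∧ᴰ dio-entry (# 1) (# 0) (# 2) (# 3) ∧ᴰ
       -- Under the two quantifiers c and d are variables 1 and 0, exactly where `D` reads its
       -- arguments; the closing index 2 is the length l.
       dio-∀< (dio-∃ (dio-∃
         (dio-entry (# 4) (# 3) (# 2) (# 1) ∧ᴰ dio-entry (# 4) (# 3) (con 1 ⊕ # 2) (# 0) ∧ᴰ
          D))) 2))))
    (λ ν → mk⇔ (λ (l , _ , _ , p) → path-sound l p) path-complete)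

theorem2p10 : (R : ℕ → ℕ → Set) (f g : Val → ℕ) →
    DioWitnessFun f → DioWitnessFun g →
    DioWitnessRel (λ ν → R (ν 1) (ν 0)) →
    DioWitnessRel (λ ν → RTC R (f ν) (g ν))
theorem2p10 R f g F G D = dio-⇔
  (λ ν → Σ ℕ λ x → Σ ℕ λ y → x ≡ f ν × y ≡ g ν × Star R x y)
  (dio-∃ (dio-∃
    -- The witnesses for f and g expect the value at position 0 and the arguments directly above it,
    -- so each skips the other's value.
    (dio-at F (λ ν → ν 1 · (λ i → ν (2 + i))) (λ { zero → # 1 ; (suc i) → # (2 + i) }) (λ { ν zero → refl ; ν (suc i) → refl }) ∧ᴰ
     dio-at G (λ ν → ν 0 · (λ i → ν (2 + i))) (λ { zero → # 0 ; (suc i) → # (2 + i) }) (λ { ν zero → refl ; ν (suc i) → refl }) ∧ᴰ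
     dio-Star R D)))
  (λ ν → mk⇔ (λ { (_ , _ , refl , refl , p) → p }) (λ p → _ , _ , refl , refl , p))
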